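{- Let $G$ be a finite simple graph that is prismatic and co-bridge-free. Then $G$ admits a hitting set of the triangles of cardinality at most $5$, or $G$ is a Schl\"afli-prismatic graph.
   Context: A triangle is a set of three pairwise adjacent vertices. A graph $G$ is prismatic if for every triangle $T$ of $G$, every vertex of $G$ not in $T$ has exactly one neighbor in $T$. The co-bridge is the graph $C_4+2K_1$ (disjoint union of a 4-cycle and two isolated vertices); $G$ is co-bridge-free if it has no induced subgraph isomorphic to the co-bridge. A hitting set (of the triangles) of $G$ is a set of vertices meeting every triangle of $G$. The complement of the Schl\"afli graph has 27 vertices $r^i_j,s^i_j,t^i_j$ ($1\le i,j\le 3$) with adjacencies: for $1\le i,i',j,j'\le 3$, if $i\neq i'$ and $j\neq j'$ then $r^i_j r^{i'}_{j'}$, $s^i_j s^{i'}_{j'}$, $t^i_j t^{i'}_{j'}$ are edges; if $j=i'$ then $r^i_j s^{i'}_{j'}$, $s^i_j t^{i'}_{j'}$, $t^i_j r^{i'}_{j'}$ are edges; there are no other edges. A graph is Schl\"afli-prismatic if it is isomorphic to an induced subgraph of the complement of the Schl\"afli graph. -}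

module Defs where

open import Data.Nat using (ℕ; _≤_)
open import Data.Fin using (Fin; zero; suc; _≟_)
open import Data.Bool using (Bool; true; false; _∧_; _∨_; not; if_then_else_)
open import Data.Product using (Σ; _×_; _,_; ∃-syntax)
open import Data.List using (List; length)
open import Data.List.Membership.Propositional using (_∈_)
open import Data.List.Relation.Unary.Unique.Propositional using (Unique)
open import Data.Sum using (_⊎_)
open import Relation.Nullary using (¬_; does)
open import Relation.Binary.PropositionalEquality using (_≡_; _≢_)
open import Function.Definitions using (Injective)

record Graph : Set where
  field
    n     : ℕ
    adj   : Fin n → Fin n → Bool
    sym   : ∀ u v → adj u v ≡ adj v u
    irrefl : ∀ u → adj u u ≡ false
open Graph public

Adj : (G : Graph) → Fin (n G) → Fin (n G) → Set
Adj G u v = adj G u v ≡ true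

-- A triangle: three pairwise adjacent vertices (pairwise distinct
-- automatically, by irreflexivity).
IsTriangle : (G : Graph) → Fin (n G) → Fin (n G) → Fin (n G) → Set
IsTriangle G a b c = Adj G a b × Adj G b c × Adj G a c

b2n : Bool → ℕ
b2n true = 1
b2n false = 0

nbrsIn : (G : Graph) → Fin (n G) → Fin (n G) → Fin (n G) → Fin (n G) → ℕ
nbrsIn G v a b c = b2n (adj G v a) Data.Nat.+ b2n (adj G v b) Data.Nat.+ b2n (adj G v c)

Prismatic : Graph → Set
Prismatic G = ∀ a b c → IsTriangle G a b c →
  ∀ v → v ≢ a → v ≢ b → v ≢ c → nbrsIn G v a b c ≡ 1

InducedIn : {V W : Set} → (W → W → Bool) → (V → V → Bool) → Set
InducedIn {V} {W} H A = Σ (W → V) λ f → Injective _≡_ _≡_ f × (∀ u v → H u v ≡ A (f u) (f v))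

-- The co-bridge C4 + 2K1 on Fin 6: 4-cycle 0-1-2-3-0, vertices 4, 5 isolated.
coBridgeAdj : Fin 6 → Fin 6 → Bool
coBridgeAdj zero (suc zero) = true
coBridgeAdj (suc zero) zero = true
coBridgeAdj (suc zero) (suc (suc zero)) = true
coBridgeAdj (suc (suc zero)) (suc zero) = true
coBridgeAdj (suc (suc zero)) (suc (suc (suc zero))) = true
coBridgeAdj (suc (suc (suc zero))) (suc (suc zero)) = true
coBridgeAdj (suc (suc (suc zero))) zero = true
coBridgeAdj zero (suc (suc (suc zero))) = true
coBridgeAdj _ _ = false

CoBridgeFree : Graph → Set
CoBridgeFree G = ¬ InducedIn coBridgeAdj (adj G)

HittingSet : (G : Graph) → List (Fin (n G)) → Set
HittingSet G S = Unique S × (∀ a b c → IsTriangle G a b c → (a ∈ S ⊎ b ∈ S ⊎ c ∈ S))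

-- Complement of the Schläfli graph. Vertex (k , i , j) with k = 0,1,2
-- standing for r, s, t; i, j ∈ {1,2,3} encoded as Fin 3.
SVertex : Set
SVertex = Fin 3 × Fin 3 × Fin 3

eqb : {m : ℕ} → Fin m → Fin m → Bool
eqb x y = does (x ≟ y)

next : Fin 3 → Fin 3
next zero = suc zero
next (suc zero) = suc (suc zero)
next (suc (suc zero)) = zero

crossArc : SVertex → SVertex → Bool
crossArc (k , i , j) (k' , i' , j') = eqb k' (next k) ∧ eqb j i'

schlafliCoAdj : SVertex → SVertex → Bool
schlafliCoAdj (k , i , j) (k' , i' , j') =
  (eqb k k' ∧ not (eqb i i') ∧ not (eqb j j'))
  ∨ crossArc (k , i , j) (k' , i' , j')
  ∨ crossArc (k' , i' , j') (k , i , j)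

SchlafliPrismatic : Graph → Set
SchlafliPrismatic G = InducedIn (adj G) schlafliCoAdj

{-# OPTIONS --safe #-}
module Submission where

-- Suppose no set of at most five vertices meets all triangles of G. Take a configuration K in G, at first
-- a triangle, and at most five vertices of K. Some triangle of G avoids them, and since every vertex outside
-- a triangle has exactly one neighbour in it, this new triangle can attach to K in few ways only. Choosing
-- the vertices well, every branch soon contains a rotator: three disjoint triangles whose perfect
-- matchings compose to a cyclic permutation of the first.
-- Given a rotator, each other vertex of G attaches to it like exactly one of the 18 other vertices of
-- the complement of the Schläfli graph. Two vertices attaching in the same way, or with an adjacency
-- other than there, contradict prismaticity or yield a co-bridge, so G embeds.

open import Defs renaming (sym to adj-sym; irrefl to adj-irrefl)
open import Data.Bool as Bool using (Bool; true; false; _∧_; _∨_; not; T; if_then_else_)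
open import Data.Bool.ListAction using (any; all)
open import Data.Bool.Properties using (T-∧; T-∨; T-≡; ∨-comm)
open import Data.Empty using (⊥; ⊥-elim)
open import Data.Fin using (Fin; zero; suc; _≟_)
import Data.Fin.Properties as Fin
open import Data.List as List using (List; []; _∷_; _++_; allFin; cartesianProduct; filterᵇ; length)
import Data.List.Membership.DecPropositional as DecMembership
open import Data.List.Membership.Propositional using (_∈_; _∉_)
open import Data.List.Membership.Propositional.Properties using (∈-allFin)
open import Data.List.Relation.Unary.All as All using (All; []; _∷_)
import Data.List.Relation.Unary.All.Properties as All
open import Data.List.Relation.Unary.Any using (here; there)
open import Data.List.Relation.Unary.Unique.Propositional using (Unique; []; _∷_)
open import Data.Maybe as Maybe using (Maybe; just; nothing; maybe′; is-just)
open import Data.Maybe.Properties using (just-injective)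
open import Data.Nat using (ℕ; zero; suc; _+_; _≤_; z≤n; s≤s)
import Data.Nat.Properties as ℕ
open import Data.Product using (Σ; _×_; _,_; proj₁; proj₂; ∃-syntax; uncurry)
open import Data.Product.Properties using (≡-dec)
open import Data.Sum using (_⊎_; inj₁; inj₂; [_,_]′)
open import Data.Unit using (⊤; tt)
open import Data.Vec as Vec using (Vec; []; _∷_; lookup; _[_]≔_; toList)
import Data.Vec.Properties as Vec
open import Data.Vec.Properties
  using (lookup-map; lookup-replicate; lookup∘update; lookup∘update′; length-toList)
open import Data.Vec.Relation.Unary.All as VAll using ([]; _∷_)
import Data.Vec.Relation.Unary.All.Properties as VAll
open import Data.Vec.Relation.Unary.AllPairs as VAllPairs using ([]; _∷_)
import Data.Vec.Relation.Unary.Any as VAny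
import Data.Vec.Relation.Unary.Any.Properties as VAny
import Data.Vec.Relation.Unary.Unique.Propositional as Vec
import Data.Vec.Relation.Unary.Unique.Propositional.Properties as Vec
open import Data.Vec.Relation.Binary.Pointwise.Inductive using (Pointwise; []; _∷_)
open import Function using (_∘_; Equivalence)
open import Relation.Binary.PropositionalEquality
  using (_≡_; _≢_; refl; sym; trans; cong; cong₂; subst; ≢-sym)
open import Relation.Binary using (DecidableEquality)
open import Relation.Nullary using (¬_; Dec; yes; no; does; contradiction; ¬?; _×-dec_; isYes)
open import Relation.Nullary.Decidable using (toWitness)

-- Finite graphs as tables.

private variable
  k m : ℕ

-- The graph induced on a list of vertices: the row of a vertex records its adjacency to the
-- vertices after it, so that extending the graph by a vertex is a cons.
data Table : ℕ → Set where
  []  : Table 0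
  _∷_ : Vec Bool m → Table m → Table (suc m)

table : {A : Set} → (A → A → Bool) → Vec A m → Table m
table e []       = []
table e (v ∷ vs) = Vec.map (e v) vs ∷ table e vs

entry : Table m → Fin m → Fin m → Bool
entry (r ∷ H) zero    zero    = false
entry (r ∷ H) zero    (suc j) = lookup r j
entry (r ∷ H) (suc i) zero    = lookup r i
entry (r ∷ H) (suc i) (suc j) = entry H i j

agree : Bool → Bool → Bool
agree true  b = b
agree false b = not b

support : Vec Bool m → List (Fin m)
support []          = []
support (true  ∷ r) = zero ∷ List.map suc (support r)
support (false ∷ r) = List.map suc (support r)

pairs : {A : Set} → List A → List (A × A)
pairs []       = []
pairs (x ∷ xs) = List.map (x ,_) xs ++ pairs xs

-- Each such edge closes a triangle with the new vertex whose row is `r`.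
links : Table m → Vec Bool m → List (Fin m × Fin m)
links H r = filterᵇ (uncurry (entry H)) (pairs (support r))

triangles : Table m → List (Fin m × Fin m × Fin m)
triangles []      = []
triangles (r ∷ H) = List.map (λ (u , v) → zero , suc u , suc v) (links H r)
                 ++ List.map (λ (u , v , w) → suc u , suc v , suc w) (triangles H)

exactlyOne : Bool → Bool → Bool → Bool
exactlyOne true  b c = not b ∧ not c
exactlyOne false b c = agree (not b) c

-- If x ~ u, v and u ~ v then x u v is a triangle, so every other w sees exactly one of x, u, v.
admissible : Table m → Vec Bool m → Bool
admissible H r = all (λ (u , v) → all (λ w →
  exactlyOne (lookup r w) (entry H u w) (entry H v w) ∨ eqb w u ∨ eqb w v) (allFin _)) (links H r)

-- Enumeration of the attachments of a new vertex.

Partial : ℕ → Set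
Partial m = Vec (Maybe Bool) m

-- `nothing` marks an undecided entry. A value contradicting an earlier one makes the branch
-- vacuously true, so entries forced by one triangle prune the branching over the next.
assign : Fin m → Bool → Partial m → (Partial m → Bool) → Bool
assign i b p κ = maybe′ (λ c → not (agree b c) ∨ κ p) (κ (p [ i ]≔ just b)) (lookup p i)

everyCompletion : Partial m → (Vec Bool m → Bool) → Bool
everyCompletion []            κ = κ []
everyCompletion (just b ∷ p)  κ = everyCompletion p (κ ∘ (b ∷_))
everyCompletion (nothing ∷ p) κ = everyCompletion p (κ ∘ (true ∷_)) ∧ everyCompletion p (κ ∘ (false ∷_))

select : Fin m → Fin m → Fin m → Partial m → (Partial m → Bool) → Bool
select a b c p κ = assign a true p λ p → assign b false p λ p → assign c false p κ

-- By prismaticity a new vertex has exactly one neighbour in each triangle, which gives three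
-- branches per triangle. Only entries at vertices in no triangle are left to be split freely at the
-- end.
everyTransversal : List (Fin m × Fin m × Fin m) → Partial m → (Vec Bool m → Bool) → Bool
everyTransversal []                 p κ = everyCompletion p κ
everyTransversal ((a , b , c) ∷ ts) p κ =
  select a b c p (λ p → everyTransversal ts p κ) ∧
  select b c a p (λ p → everyTransversal ts p κ) ∧
  select c a b p (λ p → everyTransversal ts p κ)

assignAll : List (Fin m) → Partial m → (Partial m → Bool) → Bool
assignAll []       p κ = κ p
assignAll (i ∷ is) p κ = assign i true p λ p → assignAll is p κ

-- κ holds for every way in which a new vertex adjacent to req can attach to H.
everyRow : Table m → List (Fin m) → (Vec Bool m → Bool) → Bool
everyRow H req κ = assignAll req (Vec.replicate _ nothing) λ p →
  everyTransversal (triangles H) p λ r → not (admissible H r) ∨ κ r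

-- Search for known configurations.

position : ∀ m → ℕ → Maybe (Fin m)
position zero    _       = nothing
position (suc m) zero    = just zero
position (suc m) (suc i) = Maybe.map suc (position m i)

-- Distinctness has to be tested: since `entry` is false on the diagonal, a repeated position would
-- otherwise pass for two nonadjacent vertices with the same neighbours.
fits : Table m → Fin m → Vec (Fin m) k → Vec Bool k → Bool
fits H j []       []      = true
fits H j (i ∷ js) (b ∷ r) = agree b (entry H j i) ∧ not (eqb j i) ∧ fits H j js r

embeds : Table k → Table m → Vec (Fin m) k → Bool
embeds []      H []       = true
embeds (r ∷ K) H (j ∷ js) = embeds K H js ∧ fits H j js r

positions : Vec ℕ k → (Vec (Fin m) k → Bool) → Bool
positions []       κ = κ []
positions (i ∷ is) κ = maybe′ (λ j → positions is (κ ∘ (j ∷_))) false (position _ i)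

-- Places, numbered as in the table at hand, where a configuration is to be looked for. They were found
-- by computer search; a wrong one makes a check fail, never succeed.
Hints : Set
Hints = List (∃[ k ] Table k × List (Vec ℕ k))

known : Hints → Table m → Bool
known hs H = any (λ (k , K , iss) → any (λ is → positions is (embeds K H)) iss) hs

-- Looks for a triangle one vertex at a time: reqs lists, for each vertex still to be chosen, the
-- vertices it must be adjacent to, and free marks the vertices it may coincide with. Every branch
-- has to end in a known configuration.
explore : Hints → Vec (List (Fin m)) k → Table m → Vec Bool m → Bool
explore hs []           H free = known hs H
explore hs (req ∷ reqs) H free = known hs H ∨
  (all (λ i → not (lookup free i ∧ all (entry H i) req)
              ∨ explore hs (Vec.map (i ∷_) reqs) H free) (allFin _)
   -- The new vertex takes number zero and shifts the older ones by one. Marking it free is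
   -- harmless: the vertices still to come must be adjacent to it, hence differ from it.
   ∧ everyRow H req λ r →
       explore hs (Vec.map (λ qs → zero ∷ List.map suc qs) reqs) (r ∷ H) (true ∷ free))

-- The first suc q vertices of c are the candidate hitting set. A triangle avoiding them contains exactly
-- one neighbour of vertex zero, which is chosen first: this cuts the number of branches to a third.
step : Hints → (q : ℕ) {o : ℕ} → Vec SVertex (suc q + o) → Bool
step hs q {o} c = explore hs ((zero ∷ []) ∷ [] ∷ [] ∷ []) (table schlafliCoAdj c)
  (Vec.replicate (suc q) false Vec.++ Vec.replicate o true)

-- Rigidity: attaching like vertices of the complement of the Schläfli graph.

_≟ˢ_ : DecidableEquality SVertex
_≟ˢ_ = ≡-dec _≟_ (≡-dec _≟_ _≟_)

absent? : (c : Vec SVertex m) (s : SVertex) → Dec (VAll.All (s ≢_) c)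
absent? c s = VAll.all? (λ t → ¬? (s ≟ˢ t)) c

distinct? : (c : Vec SVertex m) → Dec (Vec.Unique c)
distinct? = VAllPairs.allPairs? λ s t → ¬? (s ≟ˢ t)

placements : Vec SVertex m → List (Vec Bool m × SVertex)
placements c = List.map (λ s → Vec.map (schlafliCoAdj s) c , s)
  (filterᵇ (isYes ∘ absent? c) (cartesianProduct (allFin 3) (cartesianProduct (allFin 3) (allFin 3))))

place : List (Vec Bool m × SVertex) → Vec Bool m → Maybe SVertex
place []             r = nothing
place ((r′ , s) ∷ ss) r = if does (Vec.≡-dec Bool._≟_ r r′) then just s else place ss r

-- Requiring different places is what makes the embedding injective: two vertices that attach in the
-- same way fail this test and must be ruled out by a co-bridge.
compatible : Maybe SVertex → Bool → Maybe SVertex → Bool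
compatible (just s) b (just t) = agree b (schlafliCoAdj s t) ∧ not (does (s ≟ˢ t))
compatible _        _ _        = false

rigidRow : Hints → Table m → List (Vec Bool m × SVertex) → Vec Bool m → Vec Bool (suc m) → Bool
rigidRow hs H ss r (b ∷ r′) = compatible (place ss r′) b (place ss r) ∨ known hs ((b ∷ r′) ∷ r ∷ H)

rigidRows : Hints → Table m → List (Vec Bool m × SVertex) → Bool
rigidRows hs H ss = everyRow H [] λ r →
  is-just (place ss r) ∧ everyRow (r ∷ H) [] (rigidRow hs H ss r)

-- Two distinct vertices outside c attach like two distinct Schläfli vertices outside c and are
-- adjacent accordingly, unless one of the hints exhibits a known configuration.
rigid : Hints → Vec SVertex m → Bool
rigid hs c = isYes (distinct? c) ∧ rigidRows hs (table schlafliCoAdj c) (placements c)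

coBridge : Table 6
coBridge = table coBridgeAdj (Vec.allFin 6)

-- Soundness of the programs

T∧ : ∀ {a b} → T (a ∧ b) → T a × T b
T∧ = Equivalence.to T-∧

T∨ : ∀ {a b} → T (a ∨ b) → T a ⊎ T b
T∨ {a} = Equivalence.to (T-∨ {a})

T⇒≡ : ∀ {b} → T b → b ≡ true
T⇒≡ = Equivalence.to T-≡

modus-ponens : ∀ {a b} → T (not a ∨ b) → T a → T b
modus-ponens {true} h _ = h

agree⇒≡ : ∀ {b c} → T (agree b c) → b ≡ c
agree⇒≡ {true}  {true}  _ = refl
agree⇒≡ {false} {false} _ = refl

agree-refl : ∀ b → T (agree b b)
agree-refl true  = tt
agree-refl false = tt

eqb-refl : (i : Fin m) → T (eqb i i)
eqb-refl i with i ≟ i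
... | yes _  = tt
... | no i≢i = contradiction refl i≢i

not-eqb⇒≢ : {i j : Fin m} → T (not (eqb i j)) → i ≢ j
not-eqb⇒≢ {i = i} h refl with i ≟ i
... | no i≢i = i≢i refl

entry-table : {A : Set} {e : A → A → Bool} → (∀ u v → e u v ≡ e v u) → (∀ u → e u u ≡ false) →
  (vs : Vec A m) (i j : Fin m) → entry (table e vs) i j ≡ e (lookup vs i) (lookup vs j)
entry-table symm irr (v ∷ vs) zero    zero    = sym (irr v)
entry-table symm irr (v ∷ vs) zero    (suc j) = lookup-map j _ vs
entry-table symm irr (v ∷ vs) (suc i) zero    = trans (lookup-map i _ vs) (symm v (lookup vs i))
entry-table symm irr (v ∷ vs) (suc i) (suc j) = entry-table symm irr vs i j

support-sound : (r : Vec Bool m) → All (λ i → lookup r i ≡ true) (support r)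
support-sound []          = []
support-sound (true  ∷ r) = refl ∷ All.map⁺ (support-sound r)
support-sound (false ∷ r) = All.map⁺ (support-sound r)

pairs-sound : {A : Set} {P : A → Set} {xs : List A} → All P xs → All (λ (x , y) → P x × P y) (pairs xs)
pairs-sound []         = []
pairs-sound (px ∷ pxs) = All.++⁺ (All.map⁺ (All.map (px ,_) pxs)) (pairs-sound pxs)

filterᵇ-sound : {A : Set} (f : A → Bool) {P : A → Set} {xs : List A} →
  All P xs → All (λ x → P x × T (f x)) (filterᵇ f xs)
filterᵇ-sound f [] = []
filterᵇ-sound f {xs = x ∷ _} (px ∷ pxs) with f x in eq
... | true  = (px , Equivalence.from T-≡ eq) ∷ filterᵇ-sound f pxs
... | false = filterᵇ-sound f pxs

links-sound : (H : Table m) (r : Vec Bool m) →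
  All (λ (u , v) → (lookup r u ≡ true × lookup r v ≡ true) × T (entry H u v)) (links H r)
links-sound H r = filterᵇ-sound (uncurry (entry H)) (pairs-sound (support-sound r))

triangles-sound : (H : Table m) →
  All (λ (a , b , c) → entry H a b ≡ true × entry H b c ≡ true × entry H a c ≡ true) (triangles H)
triangles-sound []      = []
triangles-sound (r ∷ H) = All.++⁺
  (All.map⁺ (All.map (λ ((ru , rv) , uv) → ru , T⇒≡ uv , rv) (links-sound H r)))
  (All.map⁺ (triangles-sound H))

infix 4 _⊒_
_⊒_ : Vec Bool m → Partial m → Set
r ⊒ p = ∀ i {c} → lookup p i ≡ just c → lookup r i ≡ c

everyCompletion-sound : (r : Vec Bool m) (p : Partial m) (κ : Vec Bool m → Bool) →
  r ⊒ p → T (everyCompletion p κ) → T (κ r)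
everyCompletion-sound []      []           κ r⊒p h = h
everyCompletion-sound (b ∷ r) (just c ∷ p) κ r⊒p h with refl ← r⊒p zero refl =
  everyCompletion-sound r p (κ ∘ (b ∷_)) (r⊒p ∘ suc) h
everyCompletion-sound (true  ∷ r) (nothing ∷ p) κ r⊒p h =
  everyCompletion-sound r p (κ ∘ (true ∷_)) (r⊒p ∘ suc) (proj₁ (T∧ h))
everyCompletion-sound (false ∷ r) (nothing ∷ p) κ r⊒p h =
  everyCompletion-sound r p (κ ∘ (false ∷_)) (r⊒p ∘ suc)
    (proj₂ (T∧ {everyCompletion p (κ ∘ (true ∷_))} h))

Only : (Fin m → Bool) → Fin m → Fin m → Fin m → Set
Only f a b c = f a ≡ true × f b ≡ false × f c ≡ false

Transversal : (Fin m → Bool) → Fin m × Fin m × Fin m → Set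
Transversal f (a , b , c) = Only f a b c ⊎ Only f b c a ⊎ Only f c a b

module _ (r : Vec Bool m) where

  -- An actual row `r` follows one branch of the enumeration. A value that `r` really takes cannot
  -- contradict entries read off from `r`, so the continuation does run, on a partial row that `r`
  -- still completes.
  assign-sound : (i : Fin m) (b : Bool) (p : Partial m) (κ : Partial m → Bool) →
    lookup r i ≡ b → r ⊒ p → T (assign i b p κ) → ∃[ p′ ] (r ⊒ p′ × T (κ p′))
  assign-sound i b p κ ri r⊒p h with lookup p i in eq
  ... | just c  = p , r⊒p , modus-ponens h (subst (T ∘ agree b) (trans (sym ri) (r⊒p i eq)) (agree-refl b))
  ... | nothing = p [ i ]≔ just b , extended , h
    where
    extended : r ⊒ (p [ i ]≔ just b)
    extended j pj with i ≟ j
    ... | yes refl = trans ri (just-injective (trans (sym (lookup∘update i p (just b))) pj))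
    ... | no i≢j   = r⊒p j (trans (sym (lookup∘update′ (≢-sym i≢j) p (just b))) pj)

  assignAll-sound : (is : List (Fin m)) (p : Partial m) (κ : Partial m → Bool) →
    All (λ i → lookup r i ≡ true) is → r ⊒ p → T (assignAll is p κ) → ∃[ p′ ] (r ⊒ p′ × T (κ p′))
  assignAll-sound []       p κ []         r⊒p h = p , r⊒p , h
  assignAll-sound (i ∷ is) p κ (ri ∷ ris) r⊒p h =
    let p′ , r⊒p′ , h′ = assign-sound i true p (λ p → assignAll is p κ) ri r⊒p h
    in assignAll-sound is p′ κ ris r⊒p′ h′

  select-sound : (a b c : Fin m) (p : Partial m) (κ : Partial m → Bool) →
    Only (lookup r) a b c → r ⊒ p → T (select a b c p κ) → ∃[ p′ ] (r ⊒ p′ × T (κ p′))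
  select-sound a b c p κ (ra , rb , rc) r⊒p h =
    let p₁ , r⊒p₁ , h₁ = assign-sound a true p (λ p → assign b false p λ p → assign c false p κ) ra r⊒p h
        p₂ , r⊒p₂ , h₂ = assign-sound b false p₁ (λ p → assign c false p κ) rb r⊒p₁ h₁
    in assign-sound c false p₂ κ rc r⊒p₂ h₂

  everyTransversal-sound : (ts : List (Fin m × Fin m × Fin m)) (p : Partial m) (κ : Vec Bool m → Bool) →
    All (Transversal (lookup r)) ts → r ⊒ p → T (everyTransversal ts p κ) → T (κ r)
  everyTransversal-sound [] p κ [] r⊒p h = everyCompletion-sound r p κ r⊒p h
  everyTransversal-sound ((a , b , c) ∷ ts) p κ (t ∷ rts) r⊒p h = by-cases t
    where
    rest : Partial m → Bool
    rest p = everyTransversal ts p κ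
    continue : ∃[ p′ ] (r ⊒ p′ × T (rest p′)) → T (κ r)
    continue (p′ , r⊒p′ , h′) = everyTransversal-sound ts p′ κ rts r⊒p′ h′
    h₁ : T (select a b c p rest)
    h₁ = proj₁ (T∧ h)
    h₂₃ : T (select b c a p rest ∧ select c a b p rest)
    h₂₃ = proj₂ (T∧ {select a b c p rest} h)
    by-cases : Transversal (lookup r) (a , b , c) → T (κ r)
    by-cases (inj₁ o)        = continue (select-sound a b c p rest o r⊒p h₁)
    by-cases (inj₂ (inj₁ o)) = continue (select-sound b c a p rest o r⊒p (proj₁ (T∧ h₂₃)))
    by-cases (inj₂ (inj₂ o)) = continue (select-sound c a b p rest o r⊒p (proj₂ (T∧ {select b c a p rest} h₂₃)))

positions-sound : (is : Vec ℕ k) {κ : Vec (Fin m) k → Bool} → T (positions is κ) → ∃[ js ] T (κ js)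
positions-sound []       h = [] , h
positions-sound {m = m} (i ∷ is) h with position m i
... | just j = let js , h′ = positions-sound is h in j ∷ js , h′

fits-sound : (H : Table m) (j : Fin m) (is : Vec (Fin m) k) (r : Vec Bool k) → T (fits H j is r) →
  Vec.map (entry H j) is ≡ r × VAll.All (j ≢_) is
fits-sound H j []       []      h = refl , []
fits-sound H j (i ∷ is) (b ∷ r) h =
  let b≡ , h′     = T∧ {agree b (entry H j i)} h
      i≢j , h″    = T∧ {not (eqb j i)} h′
      is≡r , j∉is = fits-sound H j is r h″
  in cong₂ _∷_ (sym (agree⇒≡ b≡)) is≡r , not-eqb⇒≢ i≢j ∷ j∉is

embeds-sound : (K : Table k) (H : Table m) (js : Vec (Fin m) k) → T (embeds K H js) →
  table (entry H) js ≡ K × Vec.Unique js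
embeds-sound []      H []       h = refl , []
embeds-sound (r ∷ K) H (j ∷ js) h =
  let h₁ , h₂      = T∧ {embeds K H js} h
      js≡K , js!   = embeds-sound K H js h₁
      row≡r , j∉js = fits-sound H j js r h₂
  in cong₂ _∷_ row≡r js≡K , j∉js ∷ js!

-- Used with `f` a lookup: it turns a configuration found among the positions of a table into one
-- among the vertices of `G`.
table-map : {A B : Set} (e : B → B → Bool) (d : A → A → Bool) (f : A → B) →
  (∀ x y → d x y ≡ e (f x) (f y)) → (xs : Vec A m) → table e (Vec.map f xs) ≡ table d xs
table-map e d f h []       = refl
table-map e d f h (x ∷ xs) = cong₂ _∷_ (row x xs) (table-map e d f h xs)
  where
  row : ∀ {m} x (xs : Vec _ m) → Vec.map (e (f x)) (Vec.map f xs) ≡ Vec.map (d x) xs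
  row x []       = refl
  row x (y ∷ ys) = cong₂ _∷_ (sym (h x y)) (row x ys)

one-of-three : ∀ x y z → b2n x + b2n y + b2n z ≡ 1 →
  (x ≡ true × y ≡ false × z ≡ false) ⊎
  (y ≡ true × z ≡ false × x ≡ false) ⊎
  (z ≡ true × x ≡ false × y ≡ false)
one-of-three true  false false _ = inj₁ (refl , refl , refl)
one-of-three false true  false _ = inj₂ (inj₁ (refl , refl , refl))
one-of-three false false true  _ = inj₂ (inj₂ (refl , refl , refl))

exactlyOne-complete : ∀ x y z → b2n x + b2n y + b2n z ≡ 1 → T (exactlyOne x y z)
exactlyOne-complete x y z h with one-of-three x y z h
... | inj₁ (refl , refl , refl)        = tt
... | inj₂ (inj₁ (refl , refl , refl)) = tt
... | inj₂ (inj₂ (refl , refl , refl)) = tt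

toList-unique : {A : Set} {xs : Vec A m} → Vec.Unique xs → Unique (toList xs)
toList-unique []           = []
toList-unique (x∉xs ∷ xs!) = VAll.toList⁺ x∉xs ∷ toList-unique xs!

∉⇒fresh : {A : Set} {x : A} {xs : Vec A m} → ¬ VAny.Any (x ≡_) xs → VAll.All (x ≢_) xs
∉⇒fresh {xs = []}    h = []
∉⇒fresh {xs = _ ∷ _} h = (h ∘ VAny.here) ∷ ∉⇒fresh (h ∘ VAny.there)

-- Soundness of the search in a prismatic graph.

module PrismaticGraph (G : Graph) (prismatic : Prismatic G) where

  V : Set
  V = Fin (n G)

  E : V → V → Bool
  E = adj G

  private
    tableG : Vec V m → Table m
    tableG = table E

  Adj⇒≢ : ∀ {u v} → Adj G u v → u ≢ v
  Adj⇒≢ {u} uv refl with () ← trans (sym uv) (adj-irrefl G u)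

  Adj-sym : ∀ {u v} → Adj G u v → Adj G v u
  Adj-sym {u} {v} uv = trans (adj-sym G v u) uv

  entry-tableG : (vs : Vec V m) (i j : Fin m) → entry (tableG vs) i j ≡ E (lookup vs i) (lookup vs j)
  entry-tableG = entry-table (adj-sym G) (adj-irrefl G)

  entry⇒Adj : (vs : Vec V m) {i j : Fin m} → entry (tableG vs) i j ≡ true → Adj G (lookup vs i) (lookup vs j)
  entry⇒Adj vs {i} {j} ij = trans (sym (entry-tableG vs i j)) ij

  triangles-tableG : (vs : Vec V m) →
    All (λ (a , b , c) → IsTriangle G (lookup vs a) (lookup vs b) (lookup vs c)) (triangles (tableG vs))
  triangles-tableG vs = All.map
    (λ (ab , bc , ac) → entry⇒Adj vs ab , entry⇒Adj vs bc , entry⇒Adj vs ac)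
    (triangles-sound (tableG vs))

  -- Prismaticity for the triangles through `x`. Those inside `vs` are dealt with by `transversal`
  -- in `everyRow-sound`.
  admissible-row : ∀ {x} (vs : Vec V m) → Vec.Unique (x ∷ vs) → T (admissible (tableG vs) (Vec.map (E x) vs))
  admissible-row {m} {x} vs xvs! = All.all⁻ _ (All.map link (links-sound (tableG vs) r))
    where
    r : Vec Bool m
    r = Vec.map (E x) vs
    e : Fin m → Fin m → Bool
    e = entry (tableG vs)
    x≢ : ∀ i → lookup vs i ≢ x
    x≢ i eq with () ← Vec.lookup-injective xvs! (suc i) zero eq
    module _ {u v : Fin m} (ru : lookup r u ≡ true) (rv : lookup r v ≡ true) (uv : T (e u v)) where
      xuv : IsTriangle G x (lookup vs u) (lookup vs v)
      xuv = trans (sym (lookup-map u _ vs)) ru , entry⇒Adj vs (T⇒≡ uv) , trans (sym (lookup-map v _ vs)) rv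
      counted : ∀ w → b2n (lookup r w) + b2n (e u w) + b2n (e v w)
                      ≡ nbrsIn G (lookup vs w) x (lookup vs u) (lookup vs v)
      counted w rewrite lookup-map w (E x) vs | entry-tableG vs u w | entry-tableG vs v w
        | adj-sym G x (lookup vs w) | adj-sym G (lookup vs u) (lookup vs w)
        | adj-sym G (lookup vs v) (lookup vs w) = refl
      one : ∀ w → T (exactlyOne (lookup r w) (e u w) (e v w) ∨ eqb w u ∨ eqb w v)
      one w with w ≟ u | w ≟ v
      ... | yes _  | _      = Equivalence.from (T-∨ {exactlyOne (lookup r w) _ _}) (inj₂ tt)
      ... | no _   | yes _  = Equivalence.from (T-∨ {exactlyOne (lookup r w) _ _}) (inj₂ tt)
      ... | no w≢u | no w≢v = Equivalence.from (T-∨ {exactlyOne (lookup r w) _ _}) (inj₁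
        (exactlyOne-complete (lookup r w) (e u w) (e v w) (trans (counted w)
          (prismatic x (lookup vs u) (lookup vs v) xuv (lookup vs w) (x≢ w)
            (λ eq → w≢u (Vec.lookup-injective (VAllPairs.tail xvs!) w u eq))
            (λ eq → w≢v (Vec.lookup-injective (VAllPairs.tail xvs!) w v eq))))))
    link : ∀ {(u , v) : Fin m × Fin m} → (lookup r u ≡ true × lookup r v ≡ true) × T (e u v) → T (all _ (allFin m))
    link ((ru , rv) , uv) = All.all⁻ _ (All.universal (one ru rv uv) (allFin m))

  -- The row of a vertex `x` outside `vs` is among those enumerated: it has the required entries,
  -- meets each triangle of `vs` exactly once, and is admissible.
  everyRow-sound : ∀ {x} (vs : Vec V m) (req : List (Fin m)) (κ : Vec Bool m → Bool) → Vec.Unique (x ∷ vs) →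
    All (λ i → Adj G x (lookup vs i)) req → T (everyRow (tableG vs) req κ) → T (κ (Vec.map (E x) vs))
  everyRow-sound {m} {x} vs req κ xvs! x~req h =
    let p , r⊒p , h′ = assignAll-sound r req (Vec.replicate m nothing) _
          (All.map (λ {i} xi → trans (lookup-map i _ vs) xi) x~req)
          (λ i eq → contradiction (trans (sym (lookup-replicate i nothing)) eq) λ ()) h
    in modus-ponens
         (everyTransversal-sound r _ p _ (All.map transversal (triangles-tableG vs)) r⊒p h′)
         (admissible-row vs xvs!)
    where
    r : Vec Bool m
    r = Vec.map (E x) vs
    x≢ : ∀ i → x ≢ lookup vs i
    x≢ i eq with () ← Vec.lookup-injective xvs! zero (suc i) eq
    transversal : ∀ {(a , b , c) : Fin m × Fin m × Fin m} →
      IsTriangle G (lookup vs a) (lookup vs b) (lookup vs c) → Transversal (lookup r) (a , b , c)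
    transversal {a , b , c} abc
      rewrite lookup-map a (E x) vs | lookup-map b (E x) vs | lookup-map c (E x) vs =
      one-of-three _ _ _ (prismatic _ _ _ abc x (x≢ a) (x≢ b) (x≢ c))

  SeesAll : Vec V m → List (Fin m) → V → Set
  SeesAll vs req p = All (λ i → Adj G p (lookup vs i)) req

  module _ {Goal : Set} where

    -- `Goal` is a parameter because the same search serves twice: to reach the theorem from larger
    -- configurations, and to reach `⊥` from a co-bridge.
    Closed : ∃[ k ] Table k × List (Vec ℕ k) → Set
    Closed (k , K , _) = (vs : Vec V k) → Vec.Unique vs → tableG vs ≡ K → Goal

    occurs-sound : (K : Table k) (iss : List (Vec ℕ k)) (vs : Vec V m) →
      ((us : Vec V k) → Vec.Unique us → tableG us ≡ K → Goal) → Vec.Unique vs →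
      T (any (λ is → positions is (embeds K (tableG vs))) iss) → Goal
    occurs-sound K (is ∷ iss) vs close vs! h with T∨ {positions is (embeds K (tableG vs))} h
    ... | inj₂ h′    = occurs-sound K iss vs close vs! h′
    ... | inj₁ found =
      let js , found′ = positions-sound is found
          js≡K , js!  = embeds-sound K (tableG vs) js found′
      in close (Vec.map (lookup vs) js) (Vec.map⁺ (Vec.lookup-injective vs! _ _) js!)
           (trans (table-map E (entry (tableG vs)) (lookup vs) (entry-tableG vs) js) js≡K)

    known-sound : ∀ hs (vs : Vec V m) → All Closed hs → Vec.Unique vs → T (known hs (tableG vs)) → Goal
    known-sound ((_ , K , iss) ∷ hs) vs (close ∷ closed) vs! h
      with T∨ {any (λ is → positions is (embeds K (tableG vs))) iss} h
    ... | inj₁ occurs = occurs-sound K iss vs close vs! occurs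
    ... | inj₂ h′     = known-sound hs vs closed vs! h′

    -- `ps` are the triangle vertices of `G` not yet processed. They single out one branch of the
    -- search: the next one is either an entry of `vs`, necessarily a free one, or a new vertex
    -- whose row is enumerated. Its adjacency to the later ones then joins their requirements.
    explore-sound : ∀ hs (reqs : Vec (List (Fin m)) k) (vs : Vec V m) (free : Vec Bool m) →
      All Closed hs → Vec.Unique vs →
      (ps : Vec V k) → VAllPairs.AllPairs (λ p q → Adj G q p) ps → Pointwise (SeesAll vs) reqs ps →
      VAll.All (λ p → ∀ i → p ≡ lookup vs i → T (lookup free i)) ps →
      T (explore hs reqs (tableG vs) free) → Goal
    explore-sound hs [] vs free closed vs! [] _ _ _ h = known-sound hs vs closed vs! h
    explore-sound {m = m} hs (req ∷ reqs) vs free closed vs!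
      (p ∷ ps) (p~ps ∷ ps~) (p~req ∷ ps~reqs) (p-free ∷ ps-free) h
      with T∨ {known hs (tableG vs)} h
    ... | inj₁ found = known-sound hs vs closed vs! found
    ... | inj₂ h′ with VAny.any? (p ≟_) vs | T∧ h′
    ...   | yes p∈vs | old , _ =
            explore-sound hs _ vs free closed vs! ps ps~ (extend p~ps ps~reqs) ps-free
              (modus-ponens (All.lookup (All.all⁺ _ (allFin m) old) (∈-allFin i))
                (Equivalence.from T-∧ (p-free i p≡ , All.all⁻ _ (All.map edge p~req))))
      where
      i : Fin m
      i = VAny.index p∈vs
      p≡ : p ≡ lookup vs i
      p≡ = VAny.lookup-index p∈vs
      edge : ∀ {q} → Adj G p (lookup vs q) → T (entry (tableG vs) i q)
      edge {q} pq = Equivalence.from T-≡ (trans (entry-tableG vs i q) (subst (λ u → Adj G u (lookup vs q)) p≡ pq))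
      extend : ∀ {k} {ps : Vec V k} {reqs : Vec (List (Fin m)) k} → VAll.All (λ q → Adj G q p) ps →
        Pointwise (SeesAll vs) reqs ps → Pointwise (SeesAll vs) (Vec.map (i ∷_) reqs) ps
      extend []         []                = []
      extend (qp ∷ qps) (q~req ∷ q~reqs) = (subst (Adj G _) p≡ qp ∷ q~req) ∷ extend qps q~reqs
    ...   | no p∉vs | _ , new =
            explore-sound hs _ (p ∷ vs) (true ∷ free) closed pvs! ps ps~ (extend p~ps ps~reqs)
              (VAll.map (λ { free? zero _ → tt ; free? (suc i) eq → free? i eq }) ps-free)
              (everyRow-sound vs req _ pvs! p~req new)
      where
      pvs! : Vec.Unique (p ∷ vs)
      pvs! = ∉⇒fresh p∉vs ∷ vs!
      extend : ∀ {k} {ps : Vec V k} {reqs : Vec (List (Fin m)) k} → VAll.All (λ q → Adj G q p) ps →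
        Pointwise (SeesAll vs) reqs ps →
        Pointwise (SeesAll (p ∷ vs)) (Vec.map (λ qs → zero ∷ List.map suc qs) reqs) ps
      extend []         []                = []
      extend (qp ∷ qps) (q~req ∷ q~reqs) = (qp ∷ All.map⁺ q~req) ∷ extend qps q~reqs

-- The complement of the Schläfli graph.

eqb-sym : (i j : Fin m) → eqb i j ≡ eqb j i
eqb-sym i j with i ≟ j | j ≟ i
... | yes _   | yes _   = refl
... | no _    | no _    = refl
... | yes i≡j | no j≢i  = contradiction (sym i≡j) j≢i
... | no i≢j  | yes j≡i = contradiction (sym j≡i) i≢j

schlafli-sym : ∀ s t → schlafliCoAdj s t ≡ schlafliCoAdj t s
schlafli-sym s@(k , i , j) t@(k′ , i′ , j′) =
  cong₂ _∨_ (cong₂ _∧_ (eqb-sym k k′) (cong₂ (λ a b → not a ∧ not b) (eqb-sym i i′) (eqb-sym j j′)))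
            (∨-comm (crossArc s t) (crossArc t s))

schlafli-irrefl : ∀ s → schlafliCoAdj s s ≡ false
schlafli-irrefl (k , i , j) rewrite T⇒≡ (eqb-refl i) | T⇒≡ (eqb-refl k) = no-arc k
  where
  -- `next` has no fixed point, which a case split on `k` reveals.
  no-arc : ∀ k → crossArc (k , i , j) (k , i , j) ∨ crossArc (k , i , j) (k , i , j) ≡ false
  no-arc zero             = refl
  no-arc (suc zero)       = refl
  no-arc (suc (suc zero)) = refl

Outside : Vec SVertex m → Vec Bool m × SVertex → Set
Outside c (r , s) = r ≡ Vec.map (schlafliCoAdj s) c × VAll.All (s ≢_) c

placements-sound : (c : Vec SVertex m) → All (Outside c) (placements c)
placements-sound c = All.map⁺ (All.map (λ (_ , s∉c) → refl , toWitness s∉c)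
  (filterᵇ-sound (isYes ∘ absent? c) {P = λ _ → ⊤} (All.universal _ _)))

place-sound : (c : Vec SVertex m) {ss : List (Vec Bool m × SVertex)} {r : Vec Bool m} {s : SVertex} →
  All (Outside c) ss → place ss r ≡ just s → Outside c (r , s)
place-sound c {(r′ , s) ∷ _} {r} (o ∷ os) h with Vec.≡-dec Bool._≟_ r r′
... | no _ = place-sound c os h
place-sound c (o ∷ os) refl | yes refl = o

-- Configurations and where to find them

pattern 𝟏 = zero
pattern 𝟐 = suc zero
pattern 𝟑 = suc (suc zero)

𝐫 𝐬 𝐭 : Fin 3 → Fin 3 → SVertex
𝐫 i j = 𝟏 , i , j
𝐬 i j = 𝟐 , i , j
𝐭 i j = 𝟑 , i , j

-- The triangles are 0 1 2, 3 6 7 and 4 5 8, with matchings 0-3, 1-7, 2-6; 3-5, 6-4, 7-8; 4-0, 5-1, 8-2.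
rotator : Vec SVertex 9
rotator =
  𝐫 𝟏 𝟏 ∷ 𝐫 𝟐 𝟐 ∷ 𝐫 𝟑 𝟑 ∷ 𝐫 𝟐 𝟑 ∷ 𝐬 𝟏 𝟏 ∷ 𝐫 𝟑 𝟏 ∷ 𝐬 𝟑 𝟐 ∷ 𝐭 𝟐 𝟐 ∷ 𝐭 𝟏 𝟑 ∷ []

-- The grid of all `𝐫 i j` with two `𝐬` and two `𝐭` vertices; each of the four edges between these
-- completes to a triangle with a grid vertex. Dropping `𝐭 𝟏 𝟐` leaves `K₁₂`, dropping also `𝐬 𝟐 𝟏`
-- leaves `K₁₁`. Order matters in these lists: candidate hitting sets are taken from the front.
K₁₃ : Vec SVertex 13
K₁₃ =
  𝐫 𝟏 𝟑 ∷ 𝐫 𝟑 𝟑 ∷ 𝐬 𝟏 𝟏 ∷ 𝐬 𝟐 𝟏 ∷ 𝐫 𝟐 𝟑 ∷ 𝐭 𝟏 𝟏 ∷ 𝐫 𝟑 𝟏 ∷ 𝐫 𝟑 𝟐 ∷ 𝐭 𝟏 𝟐 ∷ 𝐫 𝟏 𝟏 ∷ 𝐫 𝟏 𝟐 ∷ 𝐫 𝟐 𝟏 ∷ 𝐫 𝟐 𝟐 ∷ []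

K₁₂ : Vec SVertex 12
K₁₂ =
  𝐬 𝟏 𝟏 ∷ 𝐬 𝟐 𝟏 ∷ 𝐫 𝟏 𝟑 ∷ 𝐫 𝟏 𝟏 ∷ 𝐫 𝟏 𝟐 ∷ 𝐫 𝟑 𝟑 ∷ 𝐫 𝟐 𝟑 ∷ 𝐫 𝟐 𝟏 ∷ 𝐫 𝟑 𝟏 ∷ 𝐫 𝟐 𝟐 ∷ 𝐫 𝟑 𝟐 ∷ 𝐭 𝟏 𝟏 ∷ []

K₁₁ : Vec SVertex 11
K₁₁ =
  𝐫 𝟐 𝟐 ∷ 𝐫 𝟏 𝟑 ∷ 𝐫 𝟑 𝟏 ∷ 𝐫 𝟏 𝟐 ∷ 𝐫 𝟏 𝟏 ∷ 𝐫 𝟑 𝟐 ∷ 𝐫 𝟐 𝟑 ∷ 𝐫 𝟑 𝟑 ∷ 𝐭 𝟏 𝟏 ∷ 𝐬 𝟏 𝟏 ∷ 𝐫 𝟐 𝟏 ∷ []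

-- The complement of the rook's graph on a 3 by 3 board, isomorphic to the rook's graph itself; its
-- six triangles are the permutation matrices.
grid : Vec SVertex 9
grid =
  𝐫 𝟏 𝟏 ∷ 𝐫 𝟐 𝟐 ∷ 𝐫 𝟏 𝟑 ∷ 𝐫 𝟑 𝟑 ∷ 𝐫 𝟐 𝟑 ∷ 𝐫 𝟑 𝟏 ∷ 𝐫 𝟏 𝟐 ∷ 𝐫 𝟑 𝟐 ∷ 𝐫 𝟐 𝟏 ∷ []

K₁₂′ : Vec SVertex 12
K₁₂′ =
  𝐫 𝟏 𝟏 ∷ 𝐫 𝟏 𝟑 ∷ 𝐫 𝟐 𝟐 ∷ 𝐫 𝟐 𝟑 ∷ 𝐫 𝟏 𝟐 ∷ 𝐫 𝟑 𝟐 ∷ 𝐫 𝟐 𝟏 ∷ 𝐭 𝟏 𝟏 ∷ 𝐬 𝟑 𝟏 ∷ 𝐬 𝟐 𝟏 ∷ 𝐭 𝟏 𝟐 ∷ 𝐫 𝟑 𝟑 ∷ []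

-- A prism of `𝐫` vertices and a 4-cycle of `𝐬` and `𝐭` vertices, three of whose edges complete to
-- triangles with a prism vertex.
K₁₀ : Vec SVertex 10
K₁₀ =
  𝐫 𝟏 𝟏 ∷ 𝐫 𝟐 𝟑 ∷ 𝐭 𝟏 𝟑 ∷ 𝐫 𝟐 𝟐 ∷ 𝐫 𝟏 𝟐 ∷ 𝐬 𝟐 𝟏 ∷ 𝐬 𝟏 𝟏 ∷ 𝐫 𝟑 𝟑 ∷ 𝐭 𝟏 𝟏 ∷ 𝐫 𝟑 𝟏 ∷ []

-- A prism, a triangle through its edge from `𝐫 𝟏 𝟏` to `𝐫 𝟐 𝟐`, and another triangle through the
-- third vertex `𝐫 𝟑 𝟑` of that one.
K₉ : Vec SVertex 9
K₉ =
  𝐫 𝟏 𝟏 ∷ 𝐫 𝟐 𝟐 ∷ 𝐫 𝟑 𝟑 ∷ 𝐫 𝟏 𝟑 ∷ 𝐭 𝟏 𝟑 ∷ 𝐫 𝟐 𝟑 ∷ 𝐫 𝟑 𝟐 ∷ 𝐫 𝟑 𝟏 ∷ 𝐬 𝟑 𝟏 ∷ []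

-- A prism and a triangle meeting it in `𝐫 𝟏 𝟏` only.
K₈ : Vec SVertex 8
K₈ =
  𝐫 𝟐 𝟐 ∷ 𝐫 𝟑 𝟐 ∷ 𝐫 𝟏 𝟑 ∷ 𝐫 𝟑 𝟏 ∷ 𝐫 𝟏 𝟏 ∷ 𝐭 𝟏 𝟏 ∷ 𝐬 𝟏 𝟏 ∷ 𝐫 𝟐 𝟑 ∷ []

prism : Vec SVertex 6
prism =
  𝐫 𝟏 𝟏 ∷ 𝐫 𝟐 𝟐 ∷ 𝐫 𝟏 𝟑 ∷ 𝐫 𝟑 𝟐 ∷ 𝐫 𝟐 𝟑 ∷ 𝐫 𝟑 𝟏 ∷ []

triangle : Vec SVertex 3
triangle =
  𝐫 𝟏 𝟏 ∷ 𝐫 𝟐 𝟐 ∷ 𝐫 𝟑 𝟑 ∷ []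

at : Vec SVertex k → List (Vec ℕ k) → ∃[ k ] Table k × List (Vec ℕ k)
at c iss = _ , table schlafliCoAdj c , iss

-- The two vertices outside the rotator are numbered 0 and 1, the rotator 2 to 10.
coBridge-places : List (Vec ℕ 6)
coBridge-places =
  (10 ∷ 9 ∷ 8 ∷ 1 ∷ 2 ∷ 0 ∷ []) ∷
  (10 ∷ 9 ∷ 8 ∷ 0 ∷ 2 ∷ 1 ∷ []) ∷
  (10 ∷ 9 ∷ 1 ∷ 7 ∷ 2 ∷ 0 ∷ []) ∷
  (10 ∷ 9 ∷ 0 ∷ 7 ∷ 2 ∷ 1 ∷ []) ∷
  (10 ∷ 7 ∷ 3 ∷ 1 ∷ 8 ∷ 0 ∷ []) ∷
  (10 ∷ 7 ∷ 3 ∷ 0 ∷ 8 ∷ 1 ∷ []) ∷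
  (10 ∷ 6 ∷ 8 ∷ 1 ∷ 3 ∷ 0 ∷ []) ∷
  (10 ∷ 6 ∷ 8 ∷ 0 ∷ 3 ∷ 1 ∷ []) ∷
  (10 ∷ 6 ∷ 1 ∷ 4 ∷ 5 ∷ 0 ∷ []) ∷
  (10 ∷ 6 ∷ 0 ∷ 4 ∷ 5 ∷ 1 ∷ []) ∷
  (10 ∷ 4 ∷ 3 ∷ 1 ∷ 5 ∷ 0 ∷ []) ∷
  (10 ∷ 4 ∷ 3 ∷ 0 ∷ 5 ∷ 1 ∷ []) ∷
  (9 ∷ 5 ∷ 1 ∷ 3 ∷ 6 ∷ 0 ∷ []) ∷
  (9 ∷ 5 ∷ 0 ∷ 3 ∷ 6 ∷ 1 ∷ []) ∷
  (10 ∷ 9 ∷ 8 ∷ 4 ∷ 1 ∷ 0 ∷ []) ∷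
  (10 ∷ 9 ∷ 3 ∷ 7 ∷ 1 ∷ 0 ∷ []) ∷
  (10 ∷ 9 ∷ 3 ∷ 4 ∷ 1 ∷ 0 ∷ []) ∷
  (10 ∷ 7 ∷ 1 ∷ 0 ∷ 8 ∷ 2 ∷ []) ∷
  (10 ∷ 7 ∷ 0 ∷ 1 ∷ 8 ∷ 2 ∷ []) ∷
  (10 ∷ 6 ∷ 8 ∷ 4 ∷ 1 ∷ 0 ∷ []) ∷
  (10 ∷ 6 ∷ 1 ∷ 0 ∷ 5 ∷ 3 ∷ []) ∷
  (10 ∷ 6 ∷ 0 ∷ 1 ∷ 5 ∷ 3 ∷ []) ∷
  (9 ∷ 8 ∷ 4 ∷ 1 ∷ 7 ∷ 0 ∷ []) ∷
  (9 ∷ 8 ∷ 4 ∷ 0 ∷ 7 ∷ 1 ∷ []) ∷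
  (9 ∷ 8 ∷ 1 ∷ 0 ∷ 7 ∷ 2 ∷ []) ∷
  (9 ∷ 8 ∷ 0 ∷ 1 ∷ 7 ∷ 2 ∷ []) ∷
  (9 ∷ 5 ∷ 7 ∷ 3 ∷ 1 ∷ 0 ∷ []) ∷
  (9 ∷ 5 ∷ 1 ∷ 0 ∷ 6 ∷ 4 ∷ []) ∷
  (9 ∷ 5 ∷ 0 ∷ 1 ∷ 6 ∷ 4 ∷ []) ∷
  (9 ∷ 3 ∷ 4 ∷ 1 ∷ 6 ∷ 0 ∷ []) ∷
  (9 ∷ 3 ∷ 4 ∷ 0 ∷ 6 ∷ 1 ∷ []) ∷
  (8 ∷ 6 ∷ 2 ∷ 5 ∷ 1 ∷ 0 ∷ []) ∷
  (8 ∷ 6 ∷ 2 ∷ 4 ∷ 1 ∷ 0 ∷ []) ∷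
  (8 ∷ 6 ∷ 1 ∷ 5 ∷ 3 ∷ 0 ∷ []) ∷
  (8 ∷ 6 ∷ 0 ∷ 5 ∷ 3 ∷ 1 ∷ []) ∷
  (8 ∷ 5 ∷ 1 ∷ 0 ∷ 10 ∷ 3 ∷ []) ∷
  (8 ∷ 5 ∷ 0 ∷ 1 ∷ 10 ∷ 3 ∷ []) ∷
  (8 ∷ 4 ∷ 2 ∷ 1 ∷ 7 ∷ 0 ∷ []) ∷
  (8 ∷ 4 ∷ 2 ∷ 0 ∷ 7 ∷ 1 ∷ []) ∷
  (7 ∷ 6 ∷ 2 ∷ 5 ∷ 1 ∷ 0 ∷ []) ∷
  (7 ∷ 6 ∷ 1 ∷ 0 ∷ 9 ∷ 4 ∷ []) ∷
  (7 ∷ 6 ∷ 0 ∷ 1 ∷ 9 ∷ 4 ∷ []) ∷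
  (7 ∷ 5 ∷ 2 ∷ 3 ∷ 1 ∷ 0 ∷ []) ∷
  (4 ∷ 3 ∷ 1 ∷ 0 ∷ 6 ∷ 5 ∷ []) ∷
  (4 ∷ 3 ∷ 0 ∷ 1 ∷ 6 ∷ 5 ∷ []) ∷
  (4 ∷ 2 ∷ 1 ∷ 0 ∷ 9 ∷ 7 ∷ []) ∷
  (4 ∷ 2 ∷ 0 ∷ 1 ∷ 9 ∷ 7 ∷ []) ∷
  (3 ∷ 2 ∷ 1 ∷ 0 ∷ 10 ∷ 8 ∷ []) ∷
  (3 ∷ 2 ∷ 0 ∷ 1 ∷ 10 ∷ 8 ∷ []) ∷ []

rotator-rigid : T (rigid ((6 , coBridge , coBridge-places) ∷ []) rotator)
rotator-rigid = tt

K₁₃-hints : Hints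
K₁₃-hints =
  at rotator (
      (15 ∷ 12 ∷ 4 ∷ 11 ∷ 1 ∷ 2 ∷ 14 ∷ 5 ∷ 0 ∷ []) ∷
      (15 ∷ 12 ∷ 4 ∷ 11 ∷ 0 ∷ 2 ∷ 14 ∷ 5 ∷ 1 ∷ []) ∷
      (15 ∷ 12 ∷ 4 ∷ 9 ∷ 1 ∷ 0 ∷ 13 ∷ 7 ∷ 2 ∷ []) ∷
      (15 ∷ 12 ∷ 4 ∷ 9 ∷ 0 ∷ 1 ∷ 13 ∷ 7 ∷ 2 ∷ []) ∷
      (14 ∷ 11 ∷ 3 ∷ 10 ∷ 8 ∷ 6 ∷ 0 ∷ 1 ∷ 12 ∷ []) ∷
      (14 ∷ 11 ∷ 3 ∷ 10 ∷ 2 ∷ 1 ∷ 13 ∷ 4 ∷ 0 ∷ []) ∷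
      (14 ∷ 11 ∷ 3 ∷ 10 ∷ 2 ∷ 0 ∷ 13 ∷ 4 ∷ 1 ∷ []) ∷
      (14 ∷ 11 ∷ 3 ∷ 10 ∷ 0 ∷ 6 ∷ 13 ∷ 4 ∷ 1 ∷ []) ∷
      (14 ∷ 11 ∷ 3 ∷ 8 ∷ 10 ∷ 4 ∷ 1 ∷ 0 ∷ 13 ∷ []) ∷
      (14 ∷ 11 ∷ 3 ∷ 8 ∷ 10 ∷ 4 ∷ 0 ∷ 1 ∷ 13 ∷ []) ∷
      (14 ∷ 11 ∷ 3 ∷ 8 ∷ 5 ∷ 0 ∷ 12 ∷ 6 ∷ 1 ∷ []) ∷
      (14 ∷ 11 ∷ 3 ∷ 8 ∷ 0 ∷ 4 ∷ 12 ∷ 6 ∷ 1 ∷ []) ∷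
      (14 ∷ 11 ∷ 3 ∷ 5 ∷ 1 ∷ 9 ∷ 12 ∷ 7 ∷ 0 ∷ []) ∷
      (14 ∷ 11 ∷ 3 ∷ 5 ∷ 0 ∷ 9 ∷ 12 ∷ 7 ∷ 1 ∷ []) ∷
      (14 ∷ 11 ∷ 3 ∷ 2 ∷ 1 ∷ 7 ∷ 13 ∷ 9 ∷ 0 ∷ []) ∷
      (14 ∷ 11 ∷ 3 ∷ 2 ∷ 0 ∷ 7 ∷ 13 ∷ 9 ∷ 1 ∷ []) ∷
      (14 ∷ 10 ∷ 5 ∷ 11 ∷ 8 ∷ 6 ∷ 0 ∷ 1 ∷ 12 ∷ []) ∷
      (14 ∷ 10 ∷ 5 ∷ 11 ∷ 0 ∷ 1 ∷ 9 ∷ 6 ∷ 12 ∷ []) ∷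
      (14 ∷ 10 ∷ 5 ∷ 8 ∷ 3 ∷ 0 ∷ 12 ∷ 6 ∷ 1 ∷ []) ∷
      (14 ∷ 10 ∷ 5 ∷ 1 ∷ 11 ∷ 6 ∷ 0 ∷ 13 ∷ 9 ∷ []) ∷
      (14 ∷ 10 ∷ 5 ∷ 0 ∷ 11 ∷ 6 ∷ 1 ∷ 13 ∷ 9 ∷ []) ∷
      (14 ∷ 1 ∷ 0 ∷ 11 ∷ 10 ∷ 4 ∷ 6 ∷ 9 ∷ 13 ∷ []) ∷
      (14 ∷ 1 ∷ 0 ∷ 11 ∷ 8 ∷ 6 ∷ 4 ∷ 7 ∷ 12 ∷ []) ∷ []) ∷ []

-- Holds by evaluation, as do the other checks. Here every triangle avoiding the first five vertices
-- leads to a rotator, so the growth from the grid stops.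
K₁₃-step : T (step K₁₃-hints 4 K₁₃)
K₁₃-step = tt

K₁₂-hints : Hints
K₁₂-hints =
  at rotator (
      (14 ∷ 7 ∷ 4 ∷ 1 ∷ 6 ∷ 9 ∷ 0 ∷ 2 ∷ 13 ∷ []) ∷
      (14 ∷ 7 ∷ 4 ∷ 0 ∷ 6 ∷ 9 ∷ 1 ∷ 2 ∷ 13 ∷ []) ∷
      (13 ∷ 6 ∷ 3 ∷ 5 ∷ 4 ∷ 0 ∷ 12 ∷ 8 ∷ 1 ∷ []) ∷
      (13 ∷ 6 ∷ 3 ∷ 5 ∷ 0 ∷ 8 ∷ 11 ∷ 7 ∷ 1 ∷ []) ∷
      (13 ∷ 6 ∷ 3 ∷ 5 ∷ 0 ∷ 7 ∷ 12 ∷ 8 ∷ 1 ∷ []) ∷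
      (13 ∷ 6 ∷ 3 ∷ 4 ∷ 1 ∷ 10 ∷ 12 ∷ 9 ∷ 0 ∷ []) ∷
      (13 ∷ 6 ∷ 3 ∷ 4 ∷ 1 ∷ 9 ∷ 11 ∷ 10 ∷ 0 ∷ []) ∷
      (13 ∷ 6 ∷ 3 ∷ 4 ∷ 0 ∷ 10 ∷ 12 ∷ 9 ∷ 1 ∷ []) ∷
      (13 ∷ 6 ∷ 3 ∷ 4 ∷ 0 ∷ 9 ∷ 11 ∷ 10 ∷ 1 ∷ []) ∷
      (13 ∷ 6 ∷ 3 ∷ 2 ∷ 4 ∷ 10 ∷ 1 ∷ 0 ∷ 11 ∷ []) ∷
      (13 ∷ 6 ∷ 3 ∷ 2 ∷ 4 ∷ 10 ∷ 0 ∷ 1 ∷ 11 ∷ []) ∷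
      (13 ∷ 6 ∷ 3 ∷ 0 ∷ 5 ∷ 8 ∷ 11 ∷ 1 ∷ 12 ∷ []) ∷
      (13 ∷ 6 ∷ 3 ∷ 0 ∷ 5 ∷ 7 ∷ 12 ∷ 1 ∷ 11 ∷ []) ∷
      (13 ∷ 5 ∷ 2 ∷ 4 ∷ 6 ∷ 0 ∷ 10 ∷ 11 ∷ 1 ∷ []) ∷
      (13 ∷ 5 ∷ 2 ∷ 3 ∷ 4 ∷ 12 ∷ 1 ∷ 0 ∷ 9 ∷ []) ∷
      (13 ∷ 1 ∷ 0 ∷ 6 ∷ 5 ∷ 8 ∷ 7 ∷ 9 ∷ 12 ∷ []) ∷
      (13 ∷ 1 ∷ 0 ∷ 6 ∷ 5 ∷ 7 ∷ 8 ∷ 10 ∷ 11 ∷ []) ∷ []) ∷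
  at K₁₃ (
      (12 ∷ 7 ∷ 10 ∷ 8 ∷ 0 ∷ 3 ∷ 2 ∷ 1 ∷ 6 ∷ 9 ∷ 11 ∷ 4 ∷ 5 ∷ []) ∷
      (12 ∷ 6 ∷ 11 ∷ 9 ∷ 0 ∷ 3 ∷ 2 ∷ 1 ∷ 7 ∷ 8 ∷ 10 ∷ 4 ∷ 5 ∷ []) ∷ []) ∷ []

K₁₂-step : T (step K₁₂-hints 4 K₁₂)
K₁₂-step = tt

K₁₁-hints : Hints
K₁₁-hints =
  at rotator (
      (13 ∷ 10 ∷ 6 ∷ 12 ∷ 2 ∷ 0 ∷ 11 ∷ 7 ∷ 1 ∷ []) ∷
      (13 ∷ 10 ∷ 6 ∷ 4 ∷ 1 ∷ 0 ∷ 5 ∷ 3 ∷ 2 ∷ []) ∷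
      (12 ∷ 9 ∷ 5 ∷ 11 ∷ 7 ∷ 6 ∷ 1 ∷ 0 ∷ 8 ∷ []) ∷
      (12 ∷ 9 ∷ 5 ∷ 11 ∷ 1 ∷ 0 ∷ 10 ∷ 6 ∷ 8 ∷ []) ∷
      (12 ∷ 9 ∷ 5 ∷ 7 ∷ 11 ∷ 6 ∷ 1 ∷ 0 ∷ 10 ∷ []) ∷
      (12 ∷ 9 ∷ 5 ∷ 7 ∷ 1 ∷ 0 ∷ 8 ∷ 6 ∷ 10 ∷ []) ∷
      (12 ∷ 7 ∷ 3 ∷ 11 ∷ 5 ∷ 1 ∷ 10 ∷ 6 ∷ 0 ∷ []) ∷
      (12 ∷ 7 ∷ 3 ∷ 11 ∷ 1 ∷ 0 ∷ 10 ∷ 6 ∷ 2 ∷ []) ∷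
      (12 ∷ 7 ∷ 3 ∷ 11 ∷ 0 ∷ 1 ∷ 10 ∷ 6 ∷ 2 ∷ []) ∷
      (12 ∷ 7 ∷ 3 ∷ 9 ∷ 11 ∷ 6 ∷ 1 ∷ 0 ∷ 10 ∷ []) ∷
      (12 ∷ 7 ∷ 3 ∷ 9 ∷ 11 ∷ 6 ∷ 0 ∷ 1 ∷ 10 ∷ []) ∷
      (12 ∷ 1 ∷ 0 ∷ 5 ∷ 11 ∷ 10 ∷ 4 ∷ 8 ∷ 6 ∷ []) ∷ []) ∷
  at K₁₂ (
      (11 ∷ 0 ∷ 5 ∷ 6 ∷ 3 ∷ 7 ∷ 2 ∷ 12 ∷ 4 ∷ 8 ∷ 9 ∷ 10 ∷ []) ∷
      (10 ∷ 0 ∷ 12 ∷ 6 ∷ 4 ∷ 8 ∷ 2 ∷ 5 ∷ 3 ∷ 7 ∷ 9 ∷ 11 ∷ []) ∷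
      (10 ∷ 0 ∷ 4 ∷ 5 ∷ 2 ∷ 6 ∷ 1 ∷ 11 ∷ 3 ∷ 7 ∷ 8 ∷ 9 ∷ []) ∷
      (10 ∷ 0 ∷ 2 ∷ 5 ∷ 4 ∷ 8 ∷ 7 ∷ 11 ∷ 3 ∷ 1 ∷ 6 ∷ 9 ∷ []) ∷
      (9 ∷ 0 ∷ 11 ∷ 5 ∷ 3 ∷ 7 ∷ 1 ∷ 4 ∷ 2 ∷ 6 ∷ 8 ∷ 10 ∷ []) ∷
      (9 ∷ 0 ∷ 3 ∷ 5 ∷ 11 ∷ 8 ∷ 6 ∷ 4 ∷ 2 ∷ 1 ∷ 7 ∷ 10 ∷ []) ∷ []) ∷ []

K₁₁-step : T (step K₁₁-hints 4 K₁₁)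
K₁₁-step = tt

grid-hints : Hints
grid-hints =
  at K₁₁ (
      (10 ∷ 9 ∷ 4 ∷ 3 ∷ 8 ∷ 6 ∷ 7 ∷ 5 ∷ 0 ∷ 1 ∷ 2 ∷ []) ∷
      (10 ∷ 8 ∷ 5 ∷ 3 ∷ 9 ∷ 6 ∷ 2 ∷ 4 ∷ 1 ∷ 0 ∷ 7 ∷ []) ∷
      (10 ∷ 8 ∷ 5 ∷ 3 ∷ 9 ∷ 6 ∷ 2 ∷ 4 ∷ 0 ∷ 1 ∷ 7 ∷ []) ∷
      (10 ∷ 8 ∷ 5 ∷ 2 ∷ 4 ∷ 7 ∷ 3 ∷ 9 ∷ 1 ∷ 0 ∷ 6 ∷ []) ∷
      (9 ∷ 10 ∷ 4 ∷ 7 ∷ 2 ∷ 5 ∷ 3 ∷ 6 ∷ 1 ∷ 0 ∷ 8 ∷ []) ∷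
      (9 ∷ 10 ∷ 4 ∷ 7 ∷ 2 ∷ 5 ∷ 3 ∷ 6 ∷ 0 ∷ 1 ∷ 8 ∷ []) ∷
      (9 ∷ 6 ∷ 2 ∷ 3 ∷ 10 ∷ 8 ∷ 5 ∷ 4 ∷ 0 ∷ 1 ∷ 7 ∷ []) ∷
      (8 ∷ 10 ∷ 5 ∷ 2 ∷ 7 ∷ 4 ∷ 3 ∷ 6 ∷ 1 ∷ 0 ∷ 9 ∷ []) ∷ []) ∷
  at rotator (
      (11 ∷ 10 ∷ 5 ∷ 9 ∷ 2 ∷ 1 ∷ 8 ∷ 7 ∷ 0 ∷ []) ∷
      (11 ∷ 10 ∷ 5 ∷ 9 ∷ 2 ∷ 0 ∷ 8 ∷ 7 ∷ 1 ∷ []) ∷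
      (11 ∷ 10 ∷ 5 ∷ 6 ∷ 1 ∷ 0 ∷ 4 ∷ 3 ∷ 2 ∷ []) ∷
      (11 ∷ 10 ∷ 5 ∷ 6 ∷ 0 ∷ 1 ∷ 4 ∷ 3 ∷ 2 ∷ []) ∷ []) ∷ []

grid-step : T (step grid-hints 4 grid)
grid-step = tt

K₁₂′-hints : Hints
K₁₂′-hints =
  at rotator (
      (13 ∷ 8 ∷ 6 ∷ 10 ∷ 4 ∷ 12 ∷ 0 ∷ 1 ∷ 11 ∷ []) ∷
      (13 ∷ 8 ∷ 6 ∷ 10 ∷ 2 ∷ 1 ∷ 9 ∷ 3 ∷ 0 ∷ []) ∷
      (13 ∷ 8 ∷ 6 ∷ 10 ∷ 2 ∷ 0 ∷ 9 ∷ 3 ∷ 1 ∷ []) ∷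
      (13 ∷ 8 ∷ 6 ∷ 10 ∷ 0 ∷ 12 ∷ 9 ∷ 3 ∷ 1 ∷ []) ∷
      (13 ∷ 8 ∷ 6 ∷ 10 ∷ 0 ∷ 3 ∷ 5 ∷ 12 ∷ 1 ∷ []) ∷
      (13 ∷ 8 ∷ 6 ∷ 10 ∷ 0 ∷ 1 ∷ 5 ∷ 12 ∷ 11 ∷ []) ∷
      (13 ∷ 8 ∷ 6 ∷ 1 ∷ 10 ∷ 12 ∷ 9 ∷ 0 ∷ 5 ∷ []) ∷
      (13 ∷ 8 ∷ 6 ∷ 1 ∷ 10 ∷ 12 ∷ 0 ∷ 7 ∷ 5 ∷ []) ∷
      (13 ∷ 8 ∷ 6 ∷ 0 ∷ 10 ∷ 12 ∷ 9 ∷ 1 ∷ 5 ∷ []) ∷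
      (13 ∷ 8 ∷ 6 ∷ 0 ∷ 10 ∷ 12 ∷ 1 ∷ 7 ∷ 5 ∷ []) ∷
      (13 ∷ 4 ∷ 2 ∷ 10 ∷ 6 ∷ 0 ∷ 9 ∷ 3 ∷ 1 ∷ []) ∷
      (13 ∷ 4 ∷ 2 ∷ 8 ∷ 10 ∷ 12 ∷ 1 ∷ 0 ∷ 5 ∷ []) ∷
      (13 ∷ 1 ∷ 0 ∷ 10 ∷ 8 ∷ 3 ∷ 12 ∷ 5 ∷ 7 ∷ []) ∷
      (13 ∷ 1 ∷ 0 ∷ 10 ∷ 6 ∷ 9 ∷ 5 ∷ 12 ∷ 11 ∷ []) ∷ []) ∷
  at grid (
      (14 ∷ 11 ∷ 13 ∷ 0 ∷ 3 ∷ 6 ∷ 8 ∷ 5 ∷ 12 ∷ []) ∷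
      (14 ∷ 9 ∷ 8 ∷ 7 ∷ 5 ∷ 4 ∷ 0 ∷ 3 ∷ 6 ∷ []) ∷
      (13 ∷ 10 ∷ 12 ∷ 0 ∷ 2 ∷ 5 ∷ 7 ∷ 4 ∷ 11 ∷ []) ∷
      (13 ∷ 8 ∷ 7 ∷ 6 ∷ 4 ∷ 3 ∷ 0 ∷ 2 ∷ 5 ∷ []) ∷
      (12 ∷ 9 ∷ 11 ∷ 0 ∷ 1 ∷ 4 ∷ 6 ∷ 3 ∷ 10 ∷ []) ∷
      (12 ∷ 7 ∷ 11 ∷ 5 ∷ 1 ∷ 0 ∷ 8 ∷ 3 ∷ 10 ∷ []) ∷ []) ∷ []

K₁₂′-step : T (step K₁₂′-hints 4 K₁₂′)
K₁₂′-step = tt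

K₁₀-hints : Hints
K₁₀-hints =
  at rotator (
      (12 ∷ 9 ∷ 5 ∷ 7 ∷ 2 ∷ 1 ∷ 8 ∷ 11 ∷ 0 ∷ []) ∷
      (12 ∷ 9 ∷ 5 ∷ 7 ∷ 2 ∷ 0 ∷ 8 ∷ 11 ∷ 1 ∷ []) ∷
      (12 ∷ 9 ∷ 5 ∷ 1 ∷ 7 ∷ 11 ∷ 2 ∷ 0 ∷ 8 ∷ []) ∷
      (12 ∷ 9 ∷ 5 ∷ 0 ∷ 7 ∷ 11 ∷ 2 ∷ 1 ∷ 8 ∷ []) ∷
      (11 ∷ 8 ∷ 4 ∷ 5 ∷ 6 ∷ 0 ∷ 9 ∷ 2 ∷ 1 ∷ []) ∷
      (11 ∷ 8 ∷ 4 ∷ 1 ∷ 6 ∷ 10 ∷ 9 ∷ 0 ∷ 7 ∷ []) ∷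
      (11 ∷ 8 ∷ 4 ∷ 1 ∷ 5 ∷ 2 ∷ 7 ∷ 0 ∷ 9 ∷ []) ∷
      (11 ∷ 8 ∷ 4 ∷ 0 ∷ 6 ∷ 10 ∷ 9 ∷ 1 ∷ 7 ∷ []) ∷
      (11 ∷ 6 ∷ 3 ∷ 5 ∷ 8 ∷ 1 ∷ 2 ∷ 9 ∷ 0 ∷ []) ∷
      (11 ∷ 6 ∷ 3 ∷ 5 ∷ 8 ∷ 0 ∷ 2 ∷ 9 ∷ 1 ∷ []) ∷
      (11 ∷ 6 ∷ 3 ∷ 4 ∷ 5 ∷ 9 ∷ 0 ∷ 1 ∷ 2 ∷ []) ∷
      (11 ∷ 6 ∷ 3 ∷ 1 ∷ 5 ∷ 9 ∷ 0 ∷ 10 ∷ 2 ∷ []) ∷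
      (11 ∷ 6 ∷ 3 ∷ 0 ∷ 5 ∷ 9 ∷ 1 ∷ 10 ∷ 2 ∷ []) ∷
      (11 ∷ 1 ∷ 0 ∷ 5 ∷ 6 ∷ 7 ∷ 9 ∷ 2 ∷ 10 ∷ []) ∷ []) ∷
  at grid (
      (11 ∷ 8 ∷ 10 ∷ 4 ∷ 5 ∷ 2 ∷ 9 ∷ 1 ∷ 0 ∷ []) ∷
      (11 ∷ 8 ∷ 10 ∷ 4 ∷ 5 ∷ 2 ∷ 9 ∷ 0 ∷ 1 ∷ []) ∷
      (10 ∷ 8 ∷ 1 ∷ 2 ∷ 7 ∷ 0 ∷ 5 ∷ 6 ∷ 9 ∷ []) ∷
      (10 ∷ 8 ∷ 1 ∷ 2 ∷ 6 ∷ 0 ∷ 9 ∷ 7 ∷ 5 ∷ []) ∷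
      (10 ∷ 7 ∷ 9 ∷ 3 ∷ 2 ∷ 1 ∷ 0 ∷ 5 ∷ 6 ∷ []) ∷ []) ∷ []

K₁₀-step : T (step K₁₀-hints 4 K₁₀)
K₁₀-step = tt

K₉-hints : Hints
K₉-hints =
  at rotator (
      (11 ∷ 7 ∷ 5 ∷ 8 ∷ 2 ∷ 1 ∷ 3 ∷ 9 ∷ 0 ∷ []) ∷
      (11 ∷ 7 ∷ 5 ∷ 6 ∷ 1 ∷ 2 ∷ 4 ∷ 10 ∷ 0 ∷ []) ∷
      (11 ∷ 7 ∷ 5 ∷ 6 ∷ 0 ∷ 2 ∷ 4 ∷ 10 ∷ 1 ∷ []) ∷
      (11 ∷ 7 ∷ 5 ∷ 2 ∷ 6 ∷ 10 ∷ 1 ∷ 0 ∷ 4 ∷ []) ∷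
      (10 ∷ 6 ∷ 4 ∷ 7 ∷ 5 ∷ 9 ∷ 1 ∷ 0 ∷ 3 ∷ []) ∷
      (10 ∷ 6 ∷ 4 ∷ 7 ∷ 5 ∷ 9 ∷ 0 ∷ 1 ∷ 3 ∷ []) ∷
      (10 ∷ 6 ∷ 4 ∷ 7 ∷ 1 ∷ 9 ∷ 2 ∷ 8 ∷ 0 ∷ []) ∷
      (10 ∷ 6 ∷ 4 ∷ 5 ∷ 7 ∷ 8 ∷ 0 ∷ 1 ∷ 2 ∷ []) ∷
      (10 ∷ 6 ∷ 4 ∷ 5 ∷ 1 ∷ 8 ∷ 3 ∷ 9 ∷ 0 ∷ []) ∷
      (10 ∷ 6 ∷ 4 ∷ 5 ∷ 0 ∷ 8 ∷ 3 ∷ 9 ∷ 1 ∷ []) ∷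
      (10 ∷ 1 ∷ 0 ∷ 7 ∷ 5 ∷ 9 ∷ 8 ∷ 2 ∷ 3 ∷ []) ∷
      (9 ∷ 5 ∷ 3 ∷ 6 ∷ 7 ∷ 8 ∷ 0 ∷ 1 ∷ 2 ∷ []) ∷ []) ∷
  at K₁₀ (
      (4 ∷ 0 ∷ 9 ∷ 10 ∷ 8 ∷ 7 ∷ 3 ∷ 6 ∷ 2 ∷ 5 ∷ []) ∷
      (4 ∷ 0 ∷ 8 ∷ 10 ∷ 9 ∷ 5 ∷ 2 ∷ 6 ∷ 3 ∷ 7 ∷ []) ∷
      (3 ∷ 0 ∷ 10 ∷ 9 ∷ 8 ∷ 7 ∷ 4 ∷ 5 ∷ 2 ∷ 6 ∷ []) ∷
      (3 ∷ 0 ∷ 8 ∷ 9 ∷ 10 ∷ 6 ∷ 2 ∷ 5 ∷ 4 ∷ 7 ∷ []) ∷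
      (3 ∷ 0 ∷ 8 ∷ 9 ∷ 7 ∷ 6 ∷ 2 ∷ 5 ∷ 1 ∷ 4 ∷ []) ∷
      (3 ∷ 0 ∷ 7 ∷ 9 ∷ 8 ∷ 4 ∷ 1 ∷ 5 ∷ 2 ∷ 6 ∷ []) ∷
      (2 ∷ 0 ∷ 9 ∷ 8 ∷ 7 ∷ 6 ∷ 3 ∷ 4 ∷ 1 ∷ 5 ∷ []) ∷
      (2 ∷ 0 ∷ 7 ∷ 8 ∷ 9 ∷ 5 ∷ 1 ∷ 4 ∷ 3 ∷ 6 ∷ []) ∷
      (1 ∷ 0 ∷ 9 ∷ 7 ∷ 8 ∷ 4 ∷ 3 ∷ 6 ∷ 2 ∷ 5 ∷ []) ∷
      (1 ∷ 0 ∷ 8 ∷ 7 ∷ 9 ∷ 5 ∷ 2 ∷ 6 ∷ 3 ∷ 4 ∷ []) ∷ []) ∷ []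

K₉-step : T (step K₉-hints 4 K₉)
K₉-step = tt

K₈-hints : Hints
K₈-hints =
  at K₉ (
      (7 ∷ 3 ∷ 2 ∷ 6 ∷ 1 ∷ 8 ∷ 9 ∷ 5 ∷ 0 ∷ []) ∷
      (7 ∷ 3 ∷ 2 ∷ 6 ∷ 0 ∷ 8 ∷ 9 ∷ 5 ∷ 1 ∷ []) ∷
      (10 ∷ 6 ∷ 1 ∷ 5 ∷ 2 ∷ 7 ∷ 4 ∷ 3 ∷ 0 ∷ []) ∷
      (10 ∷ 6 ∷ 0 ∷ 5 ∷ 2 ∷ 7 ∷ 4 ∷ 3 ∷ 1 ∷ []) ∷
      (9 ∷ 8 ∷ 7 ∷ 5 ∷ 10 ∷ 1 ∷ 6 ∷ 0 ∷ 4 ∷ []) ∷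
      (9 ∷ 8 ∷ 7 ∷ 5 ∷ 10 ∷ 0 ∷ 6 ∷ 1 ∷ 4 ∷ []) ∷
      (9 ∷ 5 ∷ 0 ∷ 4 ∷ 1 ∷ 6 ∷ 3 ∷ 2 ∷ 7 ∷ []) ∷
      (8 ∷ 5 ∷ 0 ∷ 4 ∷ 1 ∷ 6 ∷ 7 ∷ 2 ∷ 3 ∷ []) ∷
      (7 ∷ 4 ∷ 0 ∷ 5 ∷ 1 ∷ 6 ∷ 8 ∷ 2 ∷ 9 ∷ []) ∷
      (5 ∷ 4 ∷ 1 ∷ 10 ∷ 0 ∷ 3 ∷ 6 ∷ 7 ∷ 2 ∷ []) ∷
      (5 ∷ 4 ∷ 0 ∷ 10 ∷ 1 ∷ 3 ∷ 6 ∷ 7 ∷ 2 ∷ []) ∷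
      (4 ∷ 3 ∷ 0 ∷ 9 ∷ 8 ∷ 2 ∷ 5 ∷ 6 ∷ 1 ∷ []) ∷ []) ∷
  at rotator (
      (10 ∷ 7 ∷ 4 ∷ 6 ∷ 1 ∷ 0 ∷ 5 ∷ 3 ∷ 2 ∷ []) ∷
      (10 ∷ 7 ∷ 4 ∷ 6 ∷ 0 ∷ 1 ∷ 5 ∷ 3 ∷ 2 ∷ []) ∷
      (10 ∷ 7 ∷ 4 ∷ 2 ∷ 6 ∷ 3 ∷ 1 ∷ 0 ∷ 5 ∷ []) ∷
      (10 ∷ 7 ∷ 4 ∷ 2 ∷ 6 ∷ 3 ∷ 0 ∷ 1 ∷ 5 ∷ []) ∷
      (9 ∷ 6 ∷ 3 ∷ 5 ∷ 0 ∷ 8 ∷ 4 ∷ 2 ∷ 1 ∷ []) ∷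
      (9 ∷ 6 ∷ 3 ∷ 1 ∷ 5 ∷ 2 ∷ 0 ∷ 7 ∷ 4 ∷ []) ∷
      (9 ∷ 1 ∷ 0 ∷ 6 ∷ 5 ∷ 2 ∷ 8 ∷ 7 ∷ 4 ∷ []) ∷
      (8 ∷ 7 ∷ 6 ∷ 5 ∷ 1 ∷ 0 ∷ 2 ∷ 4 ∷ 3 ∷ []) ∷ []) ∷ []

K₈-step : T (step K₈-hints 4 K₈)
K₈-step = tt

prism-hints : Hints
prism-hints =
  at K₉ (
      (8 ∷ 7 ∷ 1 ∷ 6 ∷ 2 ∷ 4 ∷ 5 ∷ 3 ∷ 0 ∷ []) ∷
      (8 ∷ 7 ∷ 0 ∷ 6 ∷ 2 ∷ 4 ∷ 5 ∷ 3 ∷ 1 ∷ []) ∷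
      (6 ∷ 5 ∷ 1 ∷ 8 ∷ 0 ∷ 3 ∷ 7 ∷ 4 ∷ 2 ∷ []) ∷
      (6 ∷ 5 ∷ 0 ∷ 8 ∷ 1 ∷ 3 ∷ 7 ∷ 4 ∷ 2 ∷ []) ∷
      (4 ∷ 3 ∷ 2 ∷ 7 ∷ 1 ∷ 5 ∷ 8 ∷ 6 ∷ 0 ∷ []) ∷
      (4 ∷ 3 ∷ 2 ∷ 7 ∷ 0 ∷ 5 ∷ 8 ∷ 6 ∷ 1 ∷ []) ∷ []) ∷
  at K₈ (
      (6 ∷ 4 ∷ 5 ∷ 2 ∷ 7 ∷ 0 ∷ 1 ∷ 3 ∷ []) ∷
      (5 ∷ 7 ∷ 6 ∷ 2 ∷ 4 ∷ 0 ∷ 1 ∷ 3 ∷ []) ∷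
      (3 ∷ 6 ∷ 7 ∷ 4 ∷ 2 ∷ 1 ∷ 0 ∷ 5 ∷ []) ∷
      (3 ∷ 6 ∷ 7 ∷ 4 ∷ 2 ∷ 0 ∷ 1 ∷ 5 ∷ []) ∷ []) ∷
  at rotator (
      (8 ∷ 5 ∷ 4 ∷ 7 ∷ 2 ∷ 1 ∷ 3 ∷ 6 ∷ 0 ∷ []) ∷
      (8 ∷ 5 ∷ 4 ∷ 7 ∷ 2 ∷ 0 ∷ 3 ∷ 6 ∷ 1 ∷ []) ∷
      (8 ∷ 5 ∷ 4 ∷ 1 ∷ 7 ∷ 6 ∷ 0 ∷ 2 ∷ 3 ∷ []) ∷
      (8 ∷ 5 ∷ 4 ∷ 0 ∷ 7 ∷ 6 ∷ 1 ∷ 2 ∷ 3 ∷ []) ∷ []) ∷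
  at grid (
      (8 ∷ 7 ∷ 6 ∷ 1 ∷ 4 ∷ 3 ∷ 2 ∷ 5 ∷ 0 ∷ []) ∷
      (8 ∷ 7 ∷ 6 ∷ 0 ∷ 4 ∷ 3 ∷ 2 ∷ 5 ∷ 1 ∷ []) ∷ []) ∷ []

prism-step : T (step prism-hints 4 prism)
prism-step = tt

triangle-hints : Hints
triangle-hints =
  at prism (
      (5 ∷ 1 ∷ 2 ∷ 3 ∷ 4 ∷ 0 ∷ []) ∷
      (5 ∷ 0 ∷ 2 ∷ 3 ∷ 4 ∷ 1 ∷ []) ∷ []) ∷ []

-- A disjoint triangle is joined to the first by a perfect matching. With the edge at the anchor
-- fixed, two matchings remain, one for each hint.
triangle-step : T (step triangle-hints 2 triangle)
triangle-step = tt

-- Embedding a co-bridge-free graph around a rigid configuration.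

module _ (G : Graph) (prismatic : Prismatic G) (coBridgeFree : CoBridgeFree G) where

  open PrismaticGraph G prismatic
  open DecMembership (_≟_ {n G}) using (_∈?_)

  coBridge-closed : (vs : Vec V 6) → Vec.Unique vs → table E vs ≡ coBridge → ⊥
  coBridge-closed vs vs! eq = coBridgeFree (lookup vs , Vec.lookup-injective vs! _ _ , λ i j →
    trans (coBridge-entry i j) (trans (cong (λ H → entry H i j) (sym eq)) (entry-tableG vs i j)))
    where
    coBridge-entry : ∀ i j → coBridgeAdj i j ≡ entry coBridge i j
    coBridge-entry = toWitness {a? = Fin.all? λ i → Fin.all? λ j → coBridgeAdj i j Bool.≟ entry coBridge i j} tt

  module _ (iss : List (Vec ℕ 6)) (c : Vec SVertex m) (h : T (rigid ((6 , coBridge , iss) ∷ []) c))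
           (vs : Vec V m) (vs! : Vec.Unique vs) (vs≡c : table E vs ≡ table schlafliCoAdj c) where

    private
      H : Table m
      H = table E vs

      hints : Hints
      hints = (6 , coBridge , iss) ∷ []

      ss : List (Vec Bool m × SVertex)
      ss = placements c

      placeOf : V → Maybe SVertex
      placeOf x = place ss (Vec.map (E x) vs)

      c! : Vec.Unique c
      c! = toWitness {a? = distinct? c} (proj₁ (T∧ h))

      rows : T (rigidRows hints H ss)
      -- The check is evaluated on the concrete table of `c` and only then carried over to `vs`.
      rows = subst (λ H → T (rigidRows hints H ss)) (sym vs≡c) (proj₂ (T∧ {isYes (distinct? c)} h))

    rows-at : ∀ {x} → VAll.All (x ≢_) vs →
      T (is-just (placeOf x)) × T (everyRow (Vec.map (E x) vs ∷ H) [] (rigidRow hints H ss (Vec.map (E x) vs)))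
    rows-at {x} x∉vs = T∧ {is-just (placeOf x)} (everyRow-sound vs []
      (λ r → is-just (place ss r) ∧ everyRow (r ∷ H) [] (rigidRow hints H ss r)) (x∉vs ∷ vs!) [] rows)

    data Image (x : V) (s : SVertex) : Set where
      inside  : ∀ i → x ≡ lookup vs i → s ≡ lookup c i → Image x s
      outside : VAll.All (x ≢_) vs → placeOf x ≡ just s → Image x s

    image : ∀ x → ∃[ s ] Image x s
    image x with VAny.any? (x ≟_) vs
    ... | yes x∈vs = _ , inside (VAny.index x∈vs) (VAny.lookup-index x∈vs) refl
    ... | no x∉vs with placeOf x in eq | proj₁ (rows-at (∉⇒fresh x∉vs))
    ...   | just s | _ = s , outside (∉⇒fresh x∉vs) eq

    Faithful : V → V → SVertex → SVertex → Set
    Faithful x y s t = s ≢ t × E x y ≡ schlafliCoAdj s t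

    flip : ∀ {x y s t} → Faithful x y s t → Faithful y x t s
    flip {x} {y} {s} {t} (s≢t , xy) = ≢-sym s≢t , trans (adj-sym G y x) (trans xy (schlafli-sym s t))

    outside-inside : ∀ {x s} i → VAll.All (x ≢_) vs → placeOf x ≡ just s → Faithful x (lookup vs i) s (lookup c i)
    outside-inside i x∉vs eq with row≡ , s∉c ← place-sound c (placements-sound c) eq =
      VAll.lookup⁺ s∉c i ,
      trans (sym (lookup-map i _ vs)) (trans (cong (λ r → lookup r i) row≡) (lookup-map i _ c))

    outside-outside : ∀ {x y s t} → placeOf x ≡ just s → placeOf y ≡ just t →
      T (compatible (placeOf x) (E x y) (placeOf y)) → Faithful x y s t
    outside-outside {x} {y} {s} {t} eqx eqy h rewrite eqx | eqy with T∧ {agree (E x y) (schlafliCoAdj s t)} h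
    ... | xy≡ , s≢t with s ≟ˢ t
    ...   | no s≢t′ = s≢t′ , agree⇒≡ xy≡

    -- Inside the copy this is the equality of tables, and between inside and outside it is the row
    -- that determined the place. Only two outside vertices need the search: either their places are
    -- compatible, or the hint yields an impossible co-bridge.
    faithful : ∀ {x y s t} → Image x s → Image y t → x ≢ y → Faithful x y s t
    faithful (inside i refl refl) (inside j refl refl) x≢y =
      (λ eq → x≢y (cong (lookup vs) (Vec.lookup-injective c! i j eq))) ,
      trans (sym (entry-tableG vs i j))
        (trans (cong (λ H → entry H i j) vs≡c) (entry-table schlafli-sym schlafli-irrefl c i j))
    faithful (inside i refl refl) (outside y∉vs eq) x≢y = flip (outside-inside i y∉vs eq)
    faithful (outside x∉vs eq) (inside i refl refl) x≢y = outside-inside i x∉vs eq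
    faithful {x} {y} (outside x∉vs eqx) (outside y∉vs eqy) x≢y =
      [ outside-outside eqx eqy
      , (λ found → ⊥-elim (known-sound hints (x ∷ y ∷ vs) (coBridge-closed ∷ []) xyvs! found)) ]′
      (T∨ {compatible (placeOf x) (E x y) (placeOf y)}
        (everyRow-sound (y ∷ vs) [] (rigidRow hints H ss (Vec.map (E y) vs)) xyvs! [] (proj₂ (rows-at y∉vs))))
      where
      xyvs! : Vec.Unique (x ∷ y ∷ vs)
      xyvs! = (x≢y ∷ x∉vs) ∷ y∉vs ∷ vs!

    rigid-sound : SchlafliPrismatic G
    rigid-sound = (λ x → proj₁ (image x)) , (λ {x} {y} → injective x y) , preserves
      where
      injective : ∀ x y → proj₁ (image x) ≡ proj₁ (image y) → x ≡ y
      injective x y eq with x ≟ y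
      ... | yes x≡y = x≡y
      ... | no x≢y  = contradiction eq (proj₁ (faithful (proj₂ (image x)) (proj₂ (image y)) x≢y))
      preserves : ∀ x y → E x y ≡ schlafliCoAdj (proj₁ (image x)) (proj₁ (image y))
      preserves x y with x ≟ y
      ... | yes refl = trans (adj-irrefl G x) (sym (schlafli-irrefl (proj₁ (image x))))
      ... | no x≢y   = proj₂ (faithful (proj₂ (image x)) (proj₂ (image y)) x≢y)

  -- Small hitting sets or avoiding triangles.

  Goal : Set
  Goal = HittingSet≤5 ⊎ SchlafliPrismatic G
    where
    HittingSet≤5 : Set
    HittingSet≤5 = Σ (List V) λ S → HittingSet G S × length S ≤ 5

  AvoidingTriangle : List V → Set
  AvoidingTriangle S = ∃[ a ] ∃[ b ] ∃[ c ] (IsTriangle G a b c × a ∉ S × b ∉ S × c ∉ S)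

  avoidingTriangle? : (S : List V) → Dec (AvoidingTriangle S)
  avoidingTriangle? S = Fin.any? λ a → Fin.any? λ b → Fin.any? λ c →
    ((E a b Bool.≟ true) ×-dec (E b c Bool.≟ true) ×-dec (E a c Bool.≟ true))
    ×-dec ¬? (a ∈? S) ×-dec ¬? (b ∈? S) ×-dec ¬? (c ∈? S)

  -- Constructive because finitely many triples are tested for a decidable property.
  hitting⊎avoiding : (S : List V) → Unique S → HittingSet G S ⊎ AvoidingTriangle S
  hitting⊎avoiding S S! with avoidingTriangle? S
  ... | yes avoiding = inj₂ avoiding
  ... | no ¬avoiding = inj₁ (S! , hit)
    where
    hit : ∀ a b c → IsTriangle G a b c → a ∈ S ⊎ b ∈ S ⊎ c ∈ S
    hit a b c abc with a ∈? S | b ∈? S | c ∈? S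
    ... | yes a∈S | _       | _       = inj₁ a∈S
    ... | no _    | yes b∈S | _       = inj₂ (inj₁ b∈S)
    ... | no _    | no _    | yes c∈S = inj₂ (inj₂ c∈S)
    ... | no a∉S  | no b∉S  | no c∉S  = contradiction (a , b , c , abc , a∉S , b∉S , c∉S) ¬avoiding

  free-outside : ∀ q {o} (vs : Vec V (q + o)) i → lookup vs i ∉ toList (Vec.take q vs) →
    T (lookup (Vec.replicate q false Vec.++ Vec.replicate o true) i)
  free-outside zero    vs       i       _ rewrite lookup-replicate i true = tt
  free-outside (suc q) (v ∷ vs) zero    v∉ = contradiction (here refl) v∉
  free-outside (suc q) (v ∷ vs) (suc i) v∉ = free-outside q vs i (v∉ ∘ there)

  -- If the first `suc q` vertices of the copy hit all triangles, they are the hitting set sought.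
  -- Otherwise some triangle avoids them, and the search follows its attachment to a closed
  -- configuration.
  step-sound : ∀ hs q {o} (c : Vec SVertex (suc q + o)) → suc q ≤ 5 → T (step hs q c) → All (Closed {Goal}) hs →
    (vs : Vec V (suc q + o)) → Vec.Unique vs → table E vs ≡ table schlafliCoAdj c → Goal
  step-sound hs q {o} c q≤5 h closed vs@(v ∷ _) vs! vs≡c =
    [ (λ hitting → inj₁ (S , hitting , subst (_≤ 5) (sym (length-toList (Vec.take (suc q) vs))) q≤5))
    , from-triangle ]′ (hitting⊎avoiding S (toList-unique (Vec.take⁺ (suc q) vs!)))
    where
    S : List V
    S = toList (Vec.take (suc q) vs)
    reqs : Vec (List (Fin (suc q + o))) 3
    reqs = (zero ∷ []) ∷ [] ∷ [] ∷ []
    free : Vec Bool (suc q + o)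
    free = Vec.replicate (suc q) false Vec.++ Vec.replicate o true
    is-free : ∀ {p} → p ∉ S → ∀ i → p ≡ lookup vs i → T (lookup free i)
    is-free p∉S i refl = free-outside (suc q) vs i p∉S
    from-anchor : ∀ {p₀ p₁ p₂} → Adj G v p₀ → IsTriangle G p₀ p₁ p₂ → p₀ ∉ S → p₁ ∉ S → p₂ ∉ S → Goal
    from-anchor {p₀} {p₁} {p₂} vp₀ (p₀p₁ , p₁p₂ , p₀p₂) p₀∉S p₁∉S p₂∉S =
      explore-sound hs reqs vs free closed vs! (p₀ ∷ p₁ ∷ p₂ ∷ [])
        ((Adj-sym p₀p₁ ∷ Adj-sym p₀p₂ ∷ []) ∷ (Adj-sym p₁p₂ ∷ []) ∷ [] ∷ [])
        ((Adj-sym vp₀ ∷ []) ∷ [] ∷ [] ∷ [])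
        (is-free p₀∉S ∷ is-free p₁∉S ∷ is-free p₂∉S ∷ [])
        (subst (λ H → T (explore hs reqs H free)) (sym vs≡c) h)
    v≢ : ∀ {p} → p ∉ S → v ≢ p
    v≢ p∉S refl = p∉S (here refl)
    from-triangle : AvoidingTriangle S → Goal
    from-triangle (a , b , c , abc@(ab , bc , ac) , a∉S , b∉S , c∉S)
      -- The anchor `v` lies in `S`, hence outside the triangle; rotating the triangle puts its only
      -- neighbour first, as `step` expects.
      with one-of-three _ _ _ (prismatic a b c abc v (v≢ a∉S) (v≢ b∉S) (v≢ c∉S))
    ... | inj₁ (va , _)        = from-anchor va abc a∉S b∉S c∉S
    ... | inj₂ (inj₁ (vb , _)) = from-anchor vb (bc , Adj-sym ac , Adj-sym ab) b∉S c∉S a∉S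
    ... | inj₂ (inj₂ (vc , _)) = from-anchor vc (Adj-sym ac , ab , Adj-sym bc) c∉S a∉S b∉S

  -- From the rotator back to a single triangle.

  rotator-closed : (vs : Vec V 9) → Vec.Unique vs → table E vs ≡ table schlafliCoAdj rotator → Goal
  rotator-closed vs vs! eq = inj₂ (rigid-sound coBridge-places rotator rotator-rigid vs vs! eq)

  -- From here on each configuration relies on those its hints name, all closed before it. The
  -- argument `4` means five candidate vertices, the bound of the theorem.
  K₁₃-closed : (vs : Vec V 13) → Vec.Unique vs → table E vs ≡ table schlafliCoAdj K₁₃ → Goal
  K₁₃-closed = step-sound K₁₃-hints 4 K₁₃ ℕ.≤-refl K₁₃-step (rotator-closed ∷ [])

  K₁₂-closed : (vs : Vec V 12) → Vec.Unique vs → table E vs ≡ table schlafliCoAdj K₁₂ → Goal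
  K₁₂-closed = step-sound K₁₂-hints 4 K₁₂ ℕ.≤-refl K₁₂-step (rotator-closed ∷ K₁₃-closed ∷ [])

  K₁₁-closed : (vs : Vec V 11) → Vec.Unique vs → table E vs ≡ table schlafliCoAdj K₁₁ → Goal
  K₁₁-closed = step-sound K₁₁-hints 4 K₁₁ ℕ.≤-refl K₁₁-step (rotator-closed ∷ K₁₂-closed ∷ [])

  grid-closed : (vs : Vec V 9) → Vec.Unique vs → table E vs ≡ table schlafliCoAdj grid → Goal
  grid-closed = step-sound grid-hints 4 grid ℕ.≤-refl grid-step (K₁₁-closed ∷ rotator-closed ∷ [])

  K₁₂′-closed : (vs : Vec V 12) → Vec.Unique vs → table E vs ≡ table schlafliCoAdj K₁₂′ → Goal
  K₁₂′-closed = step-sound K₁₂′-hints 4 K₁₂′ ℕ.≤-refl K₁₂′-step (rotator-closed ∷ grid-closed ∷ [])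

  K₁₀-closed : (vs : Vec V 10) → Vec.Unique vs → table E vs ≡ table schlafliCoAdj K₁₀ → Goal
  K₁₀-closed = step-sound K₁₀-hints 4 K₁₀ ℕ.≤-refl K₁₀-step (rotator-closed ∷ grid-closed ∷ [])

  K₉-closed : (vs : Vec V 9) → Vec.Unique vs → table E vs ≡ table schlafliCoAdj K₉ → Goal
  K₉-closed = step-sound K₉-hints 4 K₉ ℕ.≤-refl K₉-step (rotator-closed ∷ K₁₀-closed ∷ [])

  K₈-closed : (vs : Vec V 8) → Vec.Unique vs → table E vs ≡ table schlafliCoAdj K₈ → Goal
  K₈-closed = step-sound K₈-hints 4 K₈ ℕ.≤-refl K₈-step (K₉-closed ∷ rotator-closed ∷ [])

  prism-closed : (vs : Vec V 6) → Vec.Unique vs → table E vs ≡ table schlafliCoAdj prism → Goal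
  prism-closed = step-sound prism-hints 4 prism ℕ.≤-refl prism-step
    (K₉-closed ∷ K₈-closed ∷ rotator-closed ∷ grid-closed ∷ [])

  triangle-closed : (vs : Vec V 3) → Vec.Unique vs → table E vs ≡ table schlafliCoAdj triangle → Goal
  -- With `2` the candidate set consists of all three vertices of the triangle.
  triangle-closed = step-sound triangle-hints 2 triangle (s≤s (s≤s (s≤s z≤n))) triangle-step (prism-closed ∷ [])

  triangle-found : ∀ {a b c} → IsTriangle G a b c → Goal
  triangle-found {a} {b} {c} (ab , bc , ac) = triangle-closed (a ∷ b ∷ c ∷ [])
    ((Adj⇒≢ ab ∷ Adj⇒≢ ac ∷ []) ∷ (Adj⇒≢ bc ∷ []) ∷ [] ∷ []) same
    where
    same : table E (a ∷ b ∷ c ∷ []) ≡ table schlafliCoAdj triangle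
    same rewrite ab | bc | ac = refl

theorem1p1 : (G : Graph) → Prismatic G → CoBridgeFree G →
    (Σ (List (Fin (n G))) λ S → HittingSet G S × length S ≤ 5) ⊎ SchlafliPrismatic G
-- For the empty set: either `G` has no triangle and nothing has to be hit, or a first triangle is
-- found.
theorem1p1 G prismatic coBridgeFree with hitting⊎avoiding G prismatic coBridgeFree [] []
... | inj₁ hitting                 = inj₁ ([] , hitting , z≤n)
... | inj₂ (a , b , c , abc , _) = triangle-found G prismatic coBridgeFree abc
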